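{- Let $\lambda/\mu$ be a skew shape, $F\in\mathrm{COF}(\lambda/\mu)$ and $i\ge1$. If $\tilde e_i(F)\neq\emptyset$, then $$\mathrm{ins}(F)=\mathrm{ins}(\tilde e_i(F))\quad\text{and}\quad e_i(\mathrm{rec}(F))=\mathrm{rec}(\tilde e_i(F)).$$ Equivalently, on biwords: let $W$ be a Burge word, let $\tilde W$ be the crystal biword obtained by reordering the columns of $W$, suppose $\tilde e_i(\tilde W)\ne\emptyset$, and let $W'$ be the Burge word obtained by reordering the columns of $\tilde e_i(\tilde W)$; then $\mathrm{ins}(W)=\mathrm{ins}(W')$ and $e_i(\mathrm{rec}(W))=\mathrm{rec}(W')$. The analogous statements hold for lowering operators: if $\tilde f_i(F)\ne\emptyset$, then $\mathrm{ins}(F)=\mathrm{ins}(\tilde f_i(F))$ and $f_i(\mathrm{rec}(F))=\mathrm{rec}(\tilde f_i(F))$, and likewise on biwords.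
   Context: Diagrams are in English notation with matrix coordinates: box $(i,j)$ lies in row $i$ (from the top) and column $j$ (from the left). Skew specialized Macdonald fillings. Let $F$ be a filling of the skew shape $\lambda/\mu$ with positive integers. A triple consists of boxes $a,b,c$ with $b,c\in\lambda/\mu$, $c$ somewhere below $b$ in the same column, and $a$ the position immediately to the left of $b$; $a$ may lie outside $\lambda/\mu$ (in $\mu$), in which case it is given value $\infty$. If $a\in\lambda/\mu$, the triple is an inversion-triple if $F(b)\le F(a)<F(c)$, or $F(a)<F(c)<F(b)$, or $F(c)<F(b)\le F(a)$; if $a\notin\lambda/\mu$ it is an inversion-triple if $F(b)>F(c)$. $\mathrm{COF}(\lambda/\mu)$ is the set of fillings $F$ of $\lambda/\mu$ such that each column has distinct entries, the first column is strictly decreasing from top to bottom, and every triple is an inversion-triple. For any sets $S_j$ of positive integers with $|S_j|=\lambda'_j-\mu'_j$ there is a unique $F\in\mathrm{COF}(\lambda/\mu)$ whose column $j$ has entry set $S_j$ for all $j$. Burge words and RSK. A Burge word is a two-line array of positive integers with pairwise distinct columns, sorted so that the top row is weakly increasing and, among columns with equal top entry, the bottom entries are decreasing. To $F\in\mathrm{COF}(\lambda/\mu)$ associate the Burge word $W(F)$ having one column $\binom{e}{j}$ for each box of $F$ in column $j$ with entry $e$. Applying RSK to a Burge word $W$ (successively row-inserting the letters of the bottom row from left to right into $P$, an inserted letter bumping the leftmost strictly larger entry of a row, and recording the corresponding top letter in the newly created box of $Q$) gives a pair $(P,Q)=(\mathrm{ins}(W),\mathrm{rec}(W))$ of the same shape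 with $P$ semistandard and the transpose $Q^t$ semistandard. Put $\mathrm{ins}(F)=\mathrm{ins}(W(F))$ and $\mathrm{rec}(F)=\mathrm{rec}(W(F))$. Crystal operators on words and tableaux. For a word $w$, replace each $i$ by a right bracket ")" and each $i+1$ by a left bracket "(", and remove matching pairs "( )" successively; the unmatched letters form a subword $i^a(i+1)^b$. $e_i(w)$ is obtained by changing the leftmost unmatched $i+1$ into $i$ (and $e_i(w)=\emptyset$ if $b=0$); $f_i(w)$ is obtained by changing the rightmost unmatched $i$ into $i+1$ (and $f_i(w)=\emptyset$ if $a=0$). On a semistandard Young tableau they act through the reading word (rows from bottom to top, each row from left to right). For a tableau $Q$ with $Q^t$ semistandard, $e_i(Q)=(e_i(Q^t))^t$ and $f_i(Q)=(f_i(Q^t))^t$. Crystal operators on fillings. The crystal biword $\tilde W$ of $F$ (or of a Burge word $W$) has the same columns $\binom{e}{j}$ as $W$, but sorted so that the bottom row is weakly decreasing and, among columns with equal bottom entry, the top entries are decreasing. $\tilde e_i(\tilde W)$ and $\tilde f_i(\tilde W)$ are obtained by applying $e_i$, respectively $f_i$, to the top row of $\tilde W$ (result $\emptyset$ if the word operator gives $\emptyset$). $\tilde e_i(F)$, $\tilde f_i(F)$ are the elements of $\mathrm{COF}(\lambda/\mu)$ (same shape) whose crystal biwords are $\tilde e_i(\tilde W)$, $\tilde f_i(\tilde W)$, or $\emptyset$ accordingly. -}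

module Defs where

open import Data.Nat using (ℕ; zero; suc; _<_; _≤_; _≥_; _<?_; _≤?_; _≟_)
open import Data.Nat.Properties using (≤-decTotalOrder)
open import Data.Fin using (Fin; zero; suc)
open import Data.List.Base
  using (List; []; _∷_; _∷ʳ_; length; map; filter; foldl; foldr; zip; concat; reverse;
         take; drop; head; last; lookup; upTo; cartesianProduct; _[_]∷=_)
open import Data.List.Relation.Unary.All using (All)
open import Data.List.Relation.Unary.Linked using (Linked)
open import Data.List.Relation.Unary.Unique.Propositional using (Unique)
import Data.List.Relation.Unary.Sorted.TotalOrder as SortedList
import Data.List.Sort as Sort
open import Data.Maybe.Base as Maybe using (Maybe; just; nothing)
open import Data.Product.Base using (_×_; _,_; proj₁; proj₂; swap)
open import Data.Product.Relation.Binary.Lex.NonStrict using (×-decTotalOrder)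
open import Data.Sum.Base using (_⊎_)
open import Level using (0ℓ)
open import Relation.Binary.Bundles using (DecTotalOrder)
import Relation.Binary.Construct.Flip.EqAndOrd as Flip
import Relation.Binary.Construct.On as On
open import Relation.Binary.PropositionalEquality using (_≡_; _≢_)
open import Relation.Nullary.Decidable using (Dec; yes; no; _×-dec_)

record Partition : Set where
  field
    parts      : List ℕ
    decreasing : Linked _≥_ parts
    positive   : All (0 <_) parts

open Partition public using (parts)

-- The i-th part, with rows numbered from 1 and value 0 when there is no
-- such row (in particular for i = 0).
nthPart : List ℕ → ℕ → ℕ
nthPart []       _             = 0
nthPart (_ ∷ _)  zero          = 0
nthPart (p ∷ _)  (suc zero)    = p
nthPart (_ ∷ ps) (suc (suc i)) = nthPart ps (suc i)

row : Partition → ℕ → ℕ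
row p = nthPart (parts p)

record SkewShape : Set where
  field
    outer inner : Partition
    contained   : ∀ i → row inner i ≤ row outer i

open SkewShape public using (outer; inner)

-- Row and column numbers start at 1.
InDiagram : Partition → ℕ → ℕ → Set
InDiagram p i j = 1 ≤ j × j ≤ row p i

Box : SkewShape → ℕ → ℕ → Set
Box S i j = row (inner S) i < j × j ≤ row (outer S) i

box? : ∀ S ((i , j) : ℕ × ℕ) → Dec (Box S i j)
box? S (i , j) = (row (inner S) i <? j) ×-dec (j ≤? row (outer S) i)

boxes : SkewShape → List (ℕ × ℕ)
boxes S = filter (box? S)
  (cartesianProduct (upTo (suc (length (parts (outer S))))) (upTo (suc (row (outer S) 1))))

-- F i j is the entry in row i and column j.  Values at positions that are
-- not boxes of the shape under consideration are never inspected.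
Filling : Set
Filling = ℕ → ℕ → ℕ

InversionTriple : (a b c : ℕ) → Set
InversionTriple a b c =
    (b ≤ a × a < c)
  ⊎ (a < c × c < b)
  ⊎ (c < b × b ≤ a)

record COF (S : SkewShape) (F : Filling) : Set where
  field
    positive    : ∀ {i j} → Box S i j → 1 ≤ F i j
    distinct    : ∀ {i i′ j} → Box S i j → Box S i′ j → i ≢ i′ → F i j ≢ F i′ j
    firstColumn : ∀ {i i′} → Box S i 1 → Box S i′ 1 → i < i′ → F i′ 1 < F i 1
    triple      : ∀ {i i′ j} → Box S i (suc j) → Box S i′ (suc j) → i < i′ →
                  Box S i j → InversionTriple (F i j) (F i (suc j)) (F i′ (suc j))
    -- the box left of b lies in the inner shape, where it has value ∞
    triple∞     : ∀ {i i′ j} → Box S i (suc j) → Box S i′ (suc j) → i < i′ →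
                  InDiagram (inner S) i j → F i′ (suc j) < F i (suc j)

-- A column is a pair (top , bottom).
Biword : Set
Biword = List (ℕ × ℕ)

≥-decTotalOrder : DecTotalOrder 0ℓ 0ℓ 0ℓ
≥-decTotalOrder = Flip.decTotalOrder ≤-decTotalOrder

-- Top entries increasing, ties by decreasing bottom entry.
burgeOrder : DecTotalOrder 0ℓ 0ℓ 0ℓ
burgeOrder = ×-decTotalOrder ≤-decTotalOrder ≥-decTotalOrder

-- Bottom entries decreasing, ties by decreasing top entry.
crystalOrder : DecTotalOrder 0ℓ 0ℓ 0ℓ
crystalOrder = On.decTotalOrder (×-decTotalOrder ≥-decTotalOrder ≥-decTotalOrder) swap

toBurge : Biword → Biword
toBurge = Sort.sort burgeOrder

toCrystal : Biword → Biword
toCrystal = Sort.sort crystalOrder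

record IsBurge (W : Biword) : Set where
  field
    positive : All (λ (t , b) → 1 ≤ t × 1 ≤ b) W
    distinct : Unique W
    sorted   : SortedList.Sorted (DecTotalOrder.totalOrder burgeOrder) W

burgeWord : SkewShape → Filling → Biword
burgeWord S F = toBurge (map (λ (i , j) → F i j , j) (boxes S))

crystalBiword : SkewShape → Filling → Biword
crystalBiword S F = toCrystal (burgeWord S F)

-- Tableaux in English notation, as the list of their rows from top to bottom.
Tableau : Set
Tableau = List (List ℕ)

-- The second component is the bumped entry, if any.
insertRow : ℕ → List ℕ → List ℕ × Maybe ℕ
insertRow x [] = x ∷ [] , nothing
insertRow x (y ∷ ys) with x <? y
... | yes _ = x ∷ ys , just y
... | no  _ = let (zs , b) = insertRow x ys in y ∷ zs , b

-- The second component is the row, numbered from 0, of the new box.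
rowInsert : ℕ → Tableau → Tableau × ℕ
rowInsert x [] = (x ∷ []) ∷ [] , 0
rowInsert x (r ∷ rs) with insertRow x r
... | r′ , nothing = r′ ∷ rs , 0
... | r′ , just y  = let (rs′ , k) = rowInsert y rs in r′ ∷ rs′ , suc k

appendToRow : ℕ → ℕ → Tableau → Tableau
appendToRow zero    t []       = (t ∷ []) ∷ []
appendToRow zero    t (r ∷ rs) = (r ∷ʳ t) ∷ rs
appendToRow (suc k) t []       = []  -- impossible when P and Q have the same shape
appendToRow (suc k) t (r ∷ rs) = r ∷ appendToRow k t rs

rskStep : Tableau × Tableau → ℕ × ℕ → Tableau × Tableau
rskStep (P , Q) (t , b) = let (P′ , k) = rowInsert b P in P′ , appendToRow k t Q

rsk : Biword → Tableau × Tableau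
rsk = foldl rskStep ([] , [])

ins rec : Biword → Tableau
ins W = proj₁ (rsk W)
rec W = proj₂ (rsk W)

insF recF : SkewShape → Filling → Tableau
insF S F = ins (burgeWord S F)
recF S F = rec (burgeWord S F)

-- Add the bracket p (a position with its letter) in front of a word of
-- brackets without matching pairs, and remove the matching pair "( )" this
-- may create; the letter i stands for ")" and i + 1 for "(".
addBracket : ∀ {n} → ℕ → Fin n × ℕ → List (Fin n × ℕ) → List (Fin n × ℕ)
addBracket i p [] = p ∷ []
addBracket i p (q ∷ qs) with proj₂ p ≟ suc i | proj₂ q ≟ i
... | yes _ | yes _ = qs
... | _     | _     = p ∷ q ∷ qs

-- The unmatched letters i and i + 1, from left to right, with their positions.
unmatched : ℕ → (w : List ℕ) → List (Fin (length w) × ℕ)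
unmatched i [] = []
unmatched i (x ∷ w) with x ≟ i | x ≟ suc i | map (λ (k , y) → suc k , y) (unmatched i w)
... | no _ | no _ | u = u
... | _    | _    | u = addBracket i (zero , x) u

-- The result ∅ is represented by nothing.
WordOperator : Set
WordOperator = ℕ → List ℕ → Maybe (List ℕ)

e : WordOperator
e i w = Maybe.map (λ (k , _) → w [ k ]∷= i)
  (head (filter (λ (_ , x) → x ≟ suc i) (unmatched i w)))

f : WordOperator
f i w = Maybe.map (λ (k , _) → w [ k ]∷= suc i)
  (last (filter (λ (_ , x) → x ≟ i) (unmatched i w)))

readingWord : Tableau → List ℕ
readingWord T = concat (reverse T)

splitBy : List ℕ → List ℕ → List (List ℕ)
splitBy []       w = []
splitBy (n ∷ ns) w = take n w ∷ splitBy ns (drop n w)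

-- The tableau of the same shape as T with reading word w.
withReadingWord : Tableau → List ℕ → Tableau
withReadingWord T w = reverse (splitBy (map length (reverse T)) w)

onTableau : WordOperator → ℕ → Tableau → Maybe Tableau
onTableau op i T = Maybe.map (withReadingWord T) (op i (readingWord T))

-- Place a new top row on a tableau given by its columns.
addTopRow : List ℕ → List (List ℕ) → List (List ℕ)
addTopRow []       cs       = cs
addTopRow (x ∷ xs) []       = (x ∷ []) ∷ addTopRow xs []
addTopRow (x ∷ xs) (c ∷ cs) = (x ∷ c) ∷ addTopRow xs cs

-- Correct for rows of weakly decreasing length.
transpose : Tableau → Tableau
transpose = foldr addTopRow []

-- The action on tableaux whose transpose is semistandard.
onTransposed : WordOperator → ℕ → Tableau → Maybe Tableau
onTransposed op i Q = Maybe.map transpose (onTableau op i (transpose Q))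

eᵗ fᵗ : ℕ → Tableau → Maybe Tableau
eᵗ = onTransposed e
fᵗ = onTransposed f

onTopRow : WordOperator → ℕ → Biword → Maybe Biword
onTopRow op i V = Maybe.map (λ t → zip t (map proj₂ V)) (op i (map proj₁ V))

ẽ f̃ : ℕ → Biword → Maybe Biword
ẽ = onTopRow e
f̃ = onTopRow f

-- IsẼ S i F F′ says that the operator ẽ i does not send F to ∅ and that F′
-- is its value: F′ is the element of COF (λ/μ), unique as a filling of the
-- boxes, whose crystal biword is ẽ i applied to that of F.
IsẼ IsF̃ : SkewShape → ℕ → Filling → Filling → Set
IsẼ S i F F′ = COF S F′ × ẽ i (crystalBiword S F) ≡ just (crystalBiword S F′)
IsF̃ S i F F′ = COF S F′ × f̃ i (crystalBiword S F) ≡ just (crystalBiword S F′)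

{-# OPTIONS --safe #-}
-- Reading the crystal biword from right to left and row-inserting its top row,
-- an inserted letter bumping the leftmost weakly larger one, produces rec W,
-- with ins W as recording tableau: this transposed insertion is symmetric to
-- RSK, row by row.  In one row, the insertion of a letter preserves the
-- unmatched brackets of the remaining word followed by the row (read from right
-- to left) and the bumped letters.  So raising the first unmatched i + 1 of the
-- top row changes no bumping position, hence not ins W, and raises the first
-- unmatched i + 1 of rec W read row by row.  Finally, reading rec W by columns
-- instead of rows matches the same brackets, because its transpose is
-- semistandard.
module Submission where

open import Defs
open import Data.Bool.Base using (true; false)
open import Data.Empty using (⊥; ⊥-elim)
open import Data.Fin.Base using (Fin; zero; suc)
open import Data.List.Base
  using (List; []; _∷_; _++_; _∷ʳ_; map; filter; head; last; length; reverse; concat; take; drop; zip; upTo;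
         cartesianProduct; _[_]∷=_)
open import Data.List.Membership.Propositional.Properties using (∈-∃++; ∈-++⁺ʳ)
open import Data.List.Properties
open import Data.List.Relation.Binary.Permutation.Propositional using (_↭_; ↭-sym; ↭⇒↭ₛ)
open import Data.List.Relation.Binary.Permutation.Propositional.Properties
  using (drop-mid; ∈-resp-↭; All-resp-↭; ↭-empty-inv)
import Data.List.Relation.Binary.Permutation.Setoid.Properties as PermSetoid
open import Data.List.Relation.Unary.All as All using (All; []; _∷_)
open import Data.List.Relation.Unary.All.Properties as All using (++⁺; ++⁻; ++⁻ˡ; ++⁻ʳ; ∷ʳ⁺)
open import Data.List.Relation.Unary.AllPairs as AllPairs using (AllPairs; []; _∷_)
import Data.List.Relation.Unary.AllPairs.Properties as AllPairs
open import Data.List.Relation.Unary.Any using (here; there)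
open import Data.List.Relation.Unary.Linked.Properties using (Linked⇒AllPairs)
import Data.List.Relation.Unary.Sorted.TotalOrder as SortedList
open import Data.List.Relation.Unary.Unique.Propositional using (Unique)
import Data.List.Relation.Unary.Unique.Propositional.Properties as Unique
open import Data.List.Reverse using (Reverse; []; _∶_∶ʳ_; reverseView)
import Data.List.Sort as Sort
open import Data.Maybe.Base as Maybe using (Maybe; just; nothing)
open import Data.Nat using (ℕ; zero; suc; pred; _+_; _∸_; _<_; _≤_; _≟_; _≡ᵇ_; _<?_; z≤n; s≤s)
open import Data.Nat.Properties
open import Data.Product.Base using (_×_; _,_; proj₁; proj₂; ∃₂; ∃-syntax; -,_)
open import Data.Sum.Base using (_⊎_; inj₁; inj₂)
open import Function.Base using (_∘_)
open import Relation.Binary.Bundles using (DecTotalOrder)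
open import Relation.Binary.Definitions using (tri<; tri≈; tri>)
open import Relation.Binary.PropositionalEquality
open import Relation.Nullary.Decidable using (Dec; yes; no)
open import Relation.Nullary.Negation using (contradiction)

-- Dual insertion

-- Changing one top entry may move its column to a distant place of the Burge word, so the RSK runs
-- on the old and the new word cannot be compared step by step. In crystal order the change happens
-- in place (`RaiseTop-sorted`), and `Dual` reads exactly this order. Its agreement with RSK is
-- proved by adding the columns in Burge order, each with a largest top so far. The operators are
-- defined by positions that survive a cancellation, and insertion moves positions. `Raise` replaces
-- them: it relates w to w′ when w′ is e applied to w and w is f applied to w′, so both operators
-- are settled together. It asks only that no opening bracket be left over in front of the letter
-- and no closing one behind it. These counts depend only on the classes of the two parts in the
-- bicyclic monoid, in which a bump is an identity. Counts alone do not tell which letter changes,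
-- so this letter is followed explicitly through each bump and each added column.

_≻_ _≺_ : ℕ × ℕ → ℕ × ℕ → Set
(t , b) ≻ (t′ , b′) = b′ < b ⊎ (b′ ≡ b × t′ < t)
(t , b) ≺ (t′ , b′) = t < t′ ⊎ (t ≡ t′ × b′ < b)

≻-trans : ∀ {x y z} → x ≻ y → y ≻ z → x ≻ z
≻-trans (inj₁ p)          (inj₁ q)          = inj₁ (<-trans q p)
≻-trans (inj₁ p)          (inj₂ (refl , _)) = inj₁ p
≻-trans (inj₂ (refl , _)) (inj₁ q)          = inj₁ q
≻-trans (inj₂ (refl , p)) (inj₂ (refl , q)) = inj₂ (refl , <-trans q p)

data Bump (t : ℕ) : List ℕ → List ℕ → ℕ → Set where
  here  : ∀ {y ys} → t ≤ y → Bump t (y ∷ ys) (t ∷ ys) y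
  there : ∀ {x xs ys y} → x < t → Bump t xs ys y → Bump t (x ∷ xs) (x ∷ ys) y

-- The tops of C are inserted from right to left into an initially empty row R,
-- which becomes a row of Q; p is the row of P and o goes on to the next row.
data Pass : Biword → List ℕ → List ℕ → Biword → Set where
  []     : Pass [] [] [] []
  append : ∀ {t b C R p o} → Pass C R p o → All (_< t) R →
           Pass ((t , b) ∷ C) (R ∷ʳ t) (p ∷ʳ b) o
  bump   : ∀ {t b C R R′ p o y} → Pass C R p o → Bump t R R′ y →
           Pass ((t , b) ∷ C) R′ p ((y , b) ∷ o)

-- Row insertion for the transposed biword, in which P is the recording tableau.
data Dual : Biword → Tableau → Tableau → Set where
  []   : Dual [] [] []
  pass : ∀ {c C R p o P Q} → Pass (c ∷ C) R p o → Dual o P Q → Dual (c ∷ C) (p ∷ P) (R ∷ Q)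

Bump-¬append : ∀ {t R R′ y} → Bump t R R′ y → All (_< t) R → ⊥
Bump-¬append (here t≤y)    (y<t ∷ _) = <⇒≱ y<t t≤y
Bump-¬append (there _ bmp) (_ ∷ R<t) = Bump-¬append bmp R<t

Bump-unique : ∀ {t R R₁ R₂ y₁ y₂} → Bump t R R₁ y₁ → Bump t R R₂ y₂ → R₁ ≡ R₂ × y₁ ≡ y₂
Bump-unique (here _)      (here _)      = refl , refl
Bump-unique (here t≤y)    (there y<t _) = contradiction t≤y (<⇒≱ y<t)
Bump-unique (there y<t _) (here t≤y)    = contradiction t≤y (<⇒≱ y<t)
Bump-unique (there _ p)   (there _ q)   with refl , refl ← Bump-unique p q = refl , refl

Pass-unique : ∀ {C R₁ R₂ p₁ p₂ o₁ o₂} → Pass C R₁ p₁ o₁ → Pass C R₂ p₂ o₂ → R₁ ≡ R₂ × p₁ ≡ p₂ × o₁ ≡ o₂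
Pass-unique []           []           = refl , refl , refl
Pass-unique (append p _) (append q _) with refl , refl , refl ← Pass-unique p q = refl , refl , refl
Pass-unique (append p a) (bump q b)   with refl , refl , refl ← Pass-unique p q = ⊥-elim (Bump-¬append b a)
Pass-unique (bump p b)   (append q a) with refl , refl , refl ← Pass-unique p q = ⊥-elim (Bump-¬append b a)
Pass-unique (bump p b)   (bump q c)   with refl , refl , refl ← Pass-unique p q
                                      with refl , refl ← Bump-unique b c = refl , refl , refl

-- Identifies the run built by raising a letter with the run that RSK of the new Burge word
-- provides.
Dual-unique : ∀ {C P₁ P₂ Q₁ Q₂} → Dual C P₁ Q₁ → Dual C P₂ Q₂ → P₁ ≡ P₂ × Q₁ ≡ Q₂
Dual-unique []         []         = refl , refl
Dual-unique (pass p d) (pass q e) with refl , refl , refl ← Pass-unique p q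
                                  with refl , refl ← Dual-unique d e = refl , refl

Bump-All : ∀ {P : ℕ → Set} {t R R′ y} → P t → All P R → Bump t R R′ y → All P R′ × P y
Bump-All pt (px ∷ ps) (here _)    = pt ∷ ps , px
Bump-All pt (px ∷ ps) (there _ b) with ps′ , py ← Bump-All pt ps b = px ∷ ps′ , py

Bump-≥ : ∀ {t R R′ y} → Bump t R R′ y → t ≤ y
Bump-≥ (here t≤y)  = t≤y
Bump-≥ (there _ b) = Bump-≥ b

Pass-tops : ∀ {P : ℕ → Set} {C R p o} → All (P ∘ proj₁) C → Pass C R p o → All P R × All (P ∘ proj₁) o
Pass-tops [] [] = [] , []
Pass-tops (pt ∷ ps) (append q _) with pR , po ← Pass-tops ps q = ∷ʳ⁺ pR pt , po
Pass-tops (pt ∷ ps) (bump q b)   with pR , po ← Pass-tops ps q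
                                 with pR′ , py ← Bump-All pt pR b = pR′ , py ∷ po

Pass-bottoms : ∀ {P : ℕ → Set} {C R p o} → All (P ∘ proj₂) C → Pass C R p o → All P p × All (P ∘ proj₂) o
Pass-bottoms [] [] = [] , []
Pass-bottoms (pb ∷ ps) (append q _) with pp , po ← Pass-bottoms ps q = ∷ʳ⁺ pp pb , po
Pass-bottoms (pb ∷ ps) (bump q _)   with pp , po ← Pass-bottoms ps q = pp , pb ∷ po

AllPairs-∷ʳ : ∀ {A : Set} {R : A → A → Set} {xs x} → AllPairs R xs → All (λ y → R y x) xs → AllPairs R (xs ∷ʳ x)
AllPairs-∷ʳ []       []       = [] ∷ []
AllPairs-∷ʳ (p ∷ ps) (q ∷ qs) = ∷ʳ⁺ p q ∷ AllPairs-∷ʳ ps qs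

Increasing : List ℕ → Set
Increasing = AllPairs _<_

Bump-increasing : ∀ {t R R′ y} → Increasing R → Bump t R R′ y → Increasing R′
Bump-increasing (p ∷ ps) (here t≤y)    = All.map (≤-<-trans t≤y) p ∷ ps
Bump-increasing (p ∷ ps) (there y<t b) = proj₁ (Bump-All y<t p b) ∷ Bump-increasing ps b

Pass-increasing : ∀ {C R p o} → Pass C R p o → Increasing R
Pass-increasing []             = []
Pass-increasing (append q R<t) = AllPairs-∷ʳ (Pass-increasing q) R<t
Pass-increasing (bump q b)     = Bump-increasing (Pass-increasing q) b

-- The entries of `R′` greater than `t` are those to the right of the bumped place. They were
-- already in `R`, behind `y`, hence exceed it.
Bump-right : ∀ {t R R′ y} {P : ℕ → Set} → Increasing R → Bump t R R′ y →
             All (λ z → t ≤ z → P z) R → P y × All (λ z → t < z → y < z × P z) R′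
Bump-right (y< ∷ _) (here t≤y) (h ∷ hs) =
  h t≤y , (λ t<t → contradiction t<t (<-irrefl refl)) ∷
          All.zipWith (λ (y<z , hz) t<z → y<z , hz (<⇒≤ t<z)) (y< , hs)
Bump-right (_ ∷ ps) (there x<t b) (_ ∷ hs) with py , hs′ ← Bump-right ps b hs =
  py , (λ t<x → contradiction t<x (<-asym x<t)) ∷ hs′

≻⇒≤ : ∀ {x y} → x ≻ y → proj₂ y ≤ proj₂ x
≻⇒≤ (inj₁ p)          = <⇒≤ p
≻⇒≤ (inj₂ (refl , _)) = ≤-refl

≻⇒< : ∀ {x y} → proj₁ x ≤ proj₁ y × x ≻ y → proj₂ y < proj₂ x
≻⇒< (_   , inj₁ y<x)       = y<x
≻⇒< (x≤y , inj₂ (_ , y<x)) = contradiction x≤y (<⇒≱ y<x)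

-- A column inserted later with the same bottom entry has a larger top entry,
-- so it bumps an entry further to the right.
Pass-sorted-∷ : ∀ {t b C R p o} → AllPairs _≻_ ((t , b) ∷ C) → Pass ((t , b) ∷ C) R p o →
                AllPairs _≻_ o × All (λ z → t < z → All ((z , b) ≻_) o) R
Pass-sorted-∷ (_ ∷ []) (append [] []) = [] , (λ _ → []) ∷ []
Pass-sorted-∷ {C = _ ∷ _} (_ ∷ s) (append q R<t) =
  proj₁ (Pass-sorted-∷ s q) ,
  ∷ʳ⁺ (All.map (λ z<t t<z → contradiction t<z (<-asym z<t)) R<t) (λ t<t → contradiction t<t (<-irrefl refl))
Pass-sorted-∷ {C = []} _ (bump [] ())
Pass-sorted-∷ {t} {b} {(t₁ , b₁) ∷ C} ((c≻ ∷ _) ∷ s) (bump {R = R} {o = o} q bmp) =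
  let s′ , inv   = Pass-sorted-∷ s q
      y≻ , inv′ = Bump-right (Pass-increasing q) bmp (right inv c≻)
  in y≻ ∷ s′ , All.map (λ h t<z → inj₂ (refl , proj₁ (h t<z)) ∷ proj₂ (h t<z)) inv′
  where
  bottoms : All (λ c → proj₂ c ≤ b₁) o
  bottoms = proj₂ (Pass-bottoms (≤-refl ∷ All.map ≻⇒≤ (AllPairs.head s)) q)
  right : All (λ z → t₁ < z → All ((z , b₁) ≻_) o) R → (t , b) ≻ (t₁ , b₁) →
          All (λ z → t ≤ z → All ((z , b) ≻_) o) R
  right inv (inj₁ b₁<b)          = All.universal (λ _ _ → All.map (λ h → inj₁ (≤-<-trans h b₁<b)) bottoms) R
  right inv (inj₂ (refl , t₁<t)) = All.map (λ h t≤z → h (<-≤-trans t₁<t t≤z)) inv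

Pass-sorted : ∀ {C R p o} → AllPairs _≻_ C → Pass C R p o → AllPairs _≻_ o
Pass-sorted []        []           = []
Pass-sorted s@(_ ∷ _) q            = proj₁ (Pass-sorted-∷ s q)

Bump-∷ʳ : ∀ {t R R′ y} z → Bump t R R′ y → Bump t (R ∷ʳ z) (R′ ∷ʳ z) y
Bump-∷ʳ z (here t≤y)    = here t≤y
Bump-∷ʳ z (there x<t b) = there x<t (Bump-∷ʳ z b)

Bump-last : ∀ {t z R} → All (_< t) R → t ≤ z → Bump t (R ∷ʳ z) (R ∷ʳ t) z
Bump-last []          t≤z = here t≤z
Bump-last (x<t ∷ R<t) t≤z = there x<t (Bump-last R<t t≤z)

Bump-< : ∀ {t s R R′ y} → All (_< t) R → Bump s R R′ y → All (_< t) R′ × y < t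
Bump-< (x<t ∷ h) (here s≤x)  = ≤-<-trans s≤x x<t ∷ h , x<t
Bump-< (x<t ∷ h) (there _ b) with h′ , y<t ← Bump-< h b = x<t ∷ h′ , y<t

-- The two outcomes of row-inserting `b` into the row `p`: either `b` ends the row and `t` is
-- recorded there, or `b` replaces `b′` and the column `(t , b′)` joins the biword of the next row.
-- The bounds on `o₁` and `o₂` repeat for that row what is assumed of `Y` and `X`.
data PassInsert (t b : ℕ) (Y X : Biword) (R p : List ℕ) (o : Biword) : Set where
  recorded : Pass (Y ++ (t , b) ∷ X) (R ∷ʳ t) (p ∷ʳ b) o →
             All (_< t) R → All (_≤ b) p → All (λ c → proj₁ c < t) o → PassInsert t b Y X R p o
  bumped   : ∀ {b′} p₁ p₂ o₁ o₂ → p ≡ p₁ ++ b′ ∷ p₂ → o ≡ o₁ ++ o₂ →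
             Pass (Y ++ (t , b) ∷ X) R (p₁ ++ b ∷ p₂) (o₁ ++ (t , b′) ∷ o₂) →
             All (_≤ b) p₁ → b < b′ →
             All (λ c → proj₁ c ≤ t) o₁ → All (λ c → proj₁ c < t) o₂ → PassInsert t b Y X R p o

-- As t is maximal, it stays at the end of the row until a later letter
-- would have been appended there; that letter bumps it instead.
passInsert : ∀ {t b} Y X {R p o} →
             All (λ c → proj₁ c ≤ t) Y → All (λ c → proj₁ c < t) X →
             All (λ c → b < proj₂ c) Y → All (λ c → proj₂ c ≤ b) X →
             Pass (Y ++ X) R p o → PassInsert t b Y X R p o
passInsert [] X [] X<t [] X≤b q with R<t , o<t ← Pass-tops X<t q =
  recorded (append q R<t) R<t (proj₁ (Pass-bottoms X≤b q)) o<t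
passInsert (c ∷ Y) X (t′≤t ∷ Y≤t) X<t (b<b″ ∷ b<Y) X≤b (append q R<t′) with passInsert Y X Y≤t X<t b<Y X≤b q
... | recorded q′ R<t p≤b o<t =
  bumped _ [] [] _ refl refl (bump q′ (Bump-last R<t′ t′≤t)) p≤b b<b″ [] o<t
-- The row is again what it is without the column `(t , b)`, so later letters do the same in both
-- runs.
... | bumped p₁ p₂ o₁ o₂ refl refl q′ p₁≤b b<b′ o₁≤t o₂<t =
  bumped p₁ (p₂ ∷ʳ proj₂ c) o₁ o₂ (++-assoc p₁ _ _) refl
    (subst (λ p → Pass _ _ p _) (++-assoc p₁ _ _) (append q′ R<t′)) p₁≤b b<b′ o₁≤t o₂<t
passInsert (c ∷ Y) X (t′≤t ∷ Y≤t) X<t (b<b″ ∷ b<Y) X≤b (bump q b) with passInsert Y X Y≤t X<t b<Y X≤b q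
... | recorded q′ R<t p≤b o<t =
  let R′<t , y<t = Bump-< R<t b in recorded (bump q′ (Bump-∷ʳ _ b)) R′<t p≤b (y<t ∷ o<t)
... | bumped p₁ p₂ o₁ o₂ refl refl q′ p₁≤b b<b′ o₁≤t o₂<t =
  bumped p₁ p₂ (_ ∷ o₁) o₂ refl refl (bump q′ b) p₁≤b b<b′ (y≤t ∷ o₁≤t) o₂<t
  where
  y≤t = proj₂ (Bump-All t′≤t (proj₁ (Pass-tops (++⁺ Y≤t (All.map <⇒≤ X<t)) q)) b)

insertRow-append : ∀ {b p} → All (_≤ b) p → insertRow b p ≡ (p ∷ʳ b , nothing)
insertRow-append [] = refl
insertRow-append {b} {x ∷ p} (x≤b ∷ p≤b) with b <? x
... | yes b<x = contradiction b<x (≤⇒≯ x≤b)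
... | no _ rewrite insertRow-append p≤b = refl

insertRow-bump : ∀ {b b′ p₁} p₂ → All (_≤ b) p₁ → b < b′ →
                 insertRow b (p₁ ++ b′ ∷ p₂) ≡ (p₁ ++ b ∷ p₂ , just b′)
insertRow-bump {b} {b′} p₂ [] b<b′ with b <? b′
... | yes _   = refl
... | no b≮b′ = contradiction b<b′ b≮b′
insertRow-bump {b} {p₁ = x ∷ _} p₂ (x≤b ∷ p≤b) b<b′ with b <? x
... | yes b<x = contradiction b<x (≤⇒≯ x≤b)
... | no _ rewrite insertRow-bump p₂ p≤b b<b′ = refl

pass-++ : ∀ Y {c X R p o P Q} → Pass (Y ++ c ∷ X) R p o → Dual o P Q → Dual (Y ++ c ∷ X) (p ∷ P) (R ∷ Q)
pass-++ []      = pass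
pass-++ (_ ∷ Y) = pass

AllPairs-split : ∀ {A : Set} {R : A → A → Set} Y {c X} → AllPairs R (Y ++ c ∷ X) →
                 All (λ y → R y c) Y × All (R c) X × AllPairs R (Y ++ X)
AllPairs-split []      (c≻X ∷ s) = [] , c≻X , s
AllPairs-split (y ∷ Y) (y≻ ∷ s) with y≻Y , y≻c ∷ y≻X ← ++⁻ Y y≻ | Y≻ , c≻X , s′ ← AllPairs-split Y s =
  y≻c ∷ Y≻ , c≻X , ++⁺ y≻Y y≻X ∷ s′

-- `passInsert` deals with one row of `P`; `Pass-sorted` gives back the crystal order, from which
-- the bounds on the bottom entries come in the next row.
Dual-insert : ∀ {t b C P Q} Y X → Dual C P Q → C ≡ Y ++ X → AllPairs _≻_ (Y ++ (t , b) ∷ X) →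
              All (λ c → proj₁ c ≤ t) Y → All (λ c → proj₁ c < t) X →
              let (P′ , Q′) = rskStep (P , Q) (t , b) in Dual (Y ++ (t , b) ∷ X) P′ Q′
Dual-insert [] [] [] refl s Y≤t X<t = pass (append [] []) []
Dual-insert Y X (pass {R = R} {p} {o} q d) eq s Y≤t X<t
  with Y≻c , c≻X , _ ← AllPairs-split Y s
  with passInsert Y X Y≤t X<t (All.zipWith ≻⇒< (Y≤t , Y≻c)) (All.map ≻⇒≤ c≻X)
                  (subst (λ C → Pass C R p o) eq q)
... | recorded q′ _ p≤b _ rewrite insertRow-append p≤b = pass-++ Y q′ d
... | bumped p₁ p₂ o₁ o₂ refl refl q′ p₁≤b b<b′ o₁≤t o₂<t rewrite insertRow-bump p₂ p₁≤b b<b′ =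
  pass-++ Y q′ (Dual-insert o₁ o₂ d refl (Pass-sorted s q′) o₁≤t o₂<t)

AllPairs-∷ʳ⁻ : ∀ {A : Set} {R : A → A → Set} xs {x} → AllPairs R (xs ∷ʳ x) → AllPairs R xs × All (λ y → R y x) xs
AllPairs-∷ʳ⁻ xs s with xs≺ , _ , s′ ← AllPairs-split xs s = subst (AllPairs _) (++-identityʳ xs) s′ , xs≺

-- Induction on the last column of `W`. Wherever it stands in `C`, removing it leaves a word in
-- crystal order with the remaining columns, and `Dual-insert` puts it back while RSK performs its
-- last step.
rsk-dual : ∀ {W C} → AllPairs _≺_ W → AllPairs _≻_ C → C ↭ W → Dual C (ins W) (rec W)
rsk-dual {W} = go (reverseView W)
  where
  go : ∀ {W C} → Reverse W → AllPairs _≺_ W → AllPairs _≻_ C → C ↭ W → Dual C (ins W) (rec W)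
  go [] _ _ C↭[] with refl ← ↭-empty-inv C↭[] = []
  go (W ∶ rW ∶ʳ c@(t , b)) sW sC C↭W
    with Y , X , refl ← ∈-∃++ (∈-resp-↭ (↭-sym C↭W) (∈-++⁺ʳ W (here refl)))
    with YX↭ ← subst (_ ↭_) (++-identityʳ W) (drop-mid Y W C↭W)
    with sW′ , W≺c ← AllPairs-∷ʳ⁻ W sW
    with Y≻c , c≻X , sC′ ← AllPairs-split Y sC
    with Y≺c , X≺c ← ++⁻ Y (All-resp-↭ (↭-sym YX↭) W≺c)
    rewrite foldl-∷ʳ rskStep ([] , []) c W
    = Dual-insert Y X (go rW sW′ sC′ YX↭) refl sC (All.map top≤ Y≺c) (All.zipWith top< (X≺c , c≻X))
    where
    top≤ : ∀ {c′} → c′ ≺ c → proj₁ c′ ≤ t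
    top≤ (inj₁ p)          = <⇒≤ p
    top≤ (inj₂ (refl , _)) = ≤-refl
    -- Equal tops would force the bottom of `c′` above `b` by the Burge order and to at most `b` by
    -- the crystal order.
    top< : ∀ {c′} → c′ ≺ c × c ≻ c′ → proj₁ c′ < t
    top< (inj₁ p           , _)               = p
    top< (inj₂ (refl , b<) , inj₁ <b)         = contradiction b< (<-asym <b)
    top< (inj₂ (refl , _)  , inj₂ (_ , t<t)) = contradiction t<t (<-irrefl refl)

-- Semistandardness of the transposed recording tableau

data Dominates : List ℕ → List ℕ → Set where
  []  : ∀ {R} → Dominates R []
  _∷_ : ∀ {x y R S} → x ≤ y → Dominates R S → Dominates (x ∷ R) (y ∷ S)

data DominatesHead (R : List ℕ) : Tableau → Set where
  []  : DominatesHead R []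
  [_] : ∀ {S Q} → Dominates R S → DominatesHead R (S ∷ Q)

-- The transpose of Q is semistandard.
data RowStrict : Tableau → Set where
  []  : RowStrict []
  addRow : ∀ {x R Q} → Increasing (x ∷ R) → DominatesHead (x ∷ R) Q → RowStrict Q → RowStrict ((x ∷ R) ∷ Q)

Dominates-refl : ∀ R → Dominates R R
Dominates-refl []      = []
Dominates-refl (x ∷ R) = ≤-refl ∷ Dominates-refl R

Dominates-∷ʳ : ∀ {R S} t → Dominates R S → Dominates (R ∷ʳ t) S
Dominates-∷ʳ t []      = []
Dominates-∷ʳ t (p ∷ d) = p ∷ Dominates-∷ʳ t d

Dominates-Bump : ∀ {t y R R′ S} → Bump t R R′ y → Dominates R S → Dominates R′ S
Dominates-Bump b             []      = []
Dominates-Bump (here t≤y)    (p ∷ d) = ≤-trans t≤y p ∷ d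
Dominates-Bump (there x<t b) (p ∷ d) = p ∷ Dominates-Bump b d

-- Below the place that `y` leaves in `R`, the row `S` has either no entry or one that is at least
-- `y`. So `y` enters `S` no further to the right than it left `R`, and there `R′` has an entry of
-- at most `y`. The same reason serves `Bump-Bump-Dominates`.
Bump-append-Dominates : ∀ {t y R R′ S} → Bump t R R′ y → All (_< y) S → Dominates R S → Dominates R′ (S ∷ʳ y)
Bump-append-Dominates (here t≤y)    _         []        = t≤y ∷ []
Bump-append-Dominates (here t≤y)    (s<y ∷ _) (y≤s ∷ _) = contradiction y≤s (<⇒≱ s<y)
Bump-append-Dominates (there x<t b) _         []        = ≤-trans (<⇒≤ x<t) (Bump-≥ b) ∷ []
Bump-append-Dominates (there _ b)   (_ ∷ S<y) (p ∷ d)   = p ∷ Bump-append-Dominates b S<y d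

Bump-Bump-Dominates : ∀ {t y z R R′ S S′} → Bump t R R′ y → Bump y S S′ z → Dominates R S → Dominates R′ S′
Bump-Bump-Dominates (here t≤y)    (here _)      (_ ∷ d)   = t≤y ∷ d
Bump-Bump-Dominates (here _)      (there s<y _) (y≤s ∷ _) = contradiction y≤s (<⇒≱ s<y)
Bump-Bump-Dominates (there x<t b) (here _)      (_ ∷ d)   = ≤-trans (<⇒≤ x<t) (Bump-≥ b) ∷ Dominates-Bump b d
Bump-Bump-Dominates (there _ b)   (there _ b′)  (p ∷ d)   = p ∷ Bump-Bump-Dominates b b′ d

Pass-Dominates : ∀ {C R S p p′ o o′} → Pass C R p o → Pass o S p′ o′ → Dominates R S
Pass-Dominates []                   []              = []
Pass-Dominates (append {t} q _)     q′              = Dominates-∷ʳ t (Pass-Dominates q q′)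
Pass-Dominates (bump q b)           (append q′ S<y) = Bump-append-Dominates b S<y (Pass-Dominates q q′)
Pass-Dominates (bump q b)           (bump q′ b′)    = Bump-Bump-Dominates b b′ (Pass-Dominates q q′)

Dual-DominatesHead : ∀ {C R p o P Q} → Pass C R p o → Dual o P Q → DominatesHead R Q
Dual-DominatesHead q []          = []
Dual-DominatesHead q (pass q′ _) = [ Pass-Dominates q q′ ]

Pass-nonempty : ∀ {c C R p o} → Pass (c ∷ C) R p o → ∃₂ λ x S → R ≡ x ∷ S
Pass-nonempty (append {R = []} _ _)    = -, -, refl
Pass-nonempty (append {R = _ ∷ _} _ _) = -, -, refl
Pass-nonempty (bump _ (here _))        = -, -, refl
Pass-nonempty (bump _ (there _ _))     = -, -, refl

Dual-RowStrict : ∀ {C P Q} → Dual C P Q → RowStrict Q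
Dual-RowStrict [] = []
Dual-RowStrict (pass q d) with Pass-increasing q | Dual-DominatesHead q d | Pass-nonempty q
... | inc | dom | _ , _ , refl = addRow inc dom (Dual-RowStrict d)

-- As for addTopRow, T is the list of columns below the row q.
data Over : List ℕ → List (List ℕ) → Set where
  []  : ∀ {q} → Over q []
  _∷_ : ∀ {x q c T} → All (x ≤_) c → Over q T → Over (x ∷ q) (c ∷ T)

Over-addTopRow : ∀ {R S T} → Dominates R S → Over S T → Over R (addTopRow S T)
Over-addTopRow []      []       = []
Over-addTopRow (p ∷ d) []       = (p ∷ []) ∷ Over-addTopRow d []
Over-addTopRow (p ∷ d) (h ∷ ov) = (p ∷ All.map (≤-trans p) h) ∷ Over-addTopRow d ov

Over-transpose : ∀ {R Q} → DominatesHead R Q → RowStrict Q → Over R (transpose Q)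
Over-transpose []    []              = []
Over-transpose [ d ] (addRow _ dom rs)  = Over-addTopRow d (Over-transpose dom rs)

-- By `Over`, the new row is at least as long as `T`, so every column gets its top entry from this
-- row and no entry of `T` slips into it.
transpose-addTopRow : ∀ {x q T} → Over (x ∷ q) T → transpose (addTopRow (x ∷ q) T) ≡ (x ∷ q) ∷ transpose T
transpose-addTopRow {q = []}    []           = refl
transpose-addTopRow {q = y ∷ q} []           rewrite transpose-addTopRow {y} {q} [] = refl
transpose-addTopRow {q = []}    (_ ∷ [])     = refl
transpose-addTopRow {q = _ ∷ _} (_ ∷ ov)     rewrite transpose-addTopRow ov = refl

transpose-involutive : ∀ {Q} → RowStrict Q → transpose (transpose Q) ≡ Q
transpose-involutive [] = refl
transpose-involutive (addRow _ dom rs) =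
  trans (transpose-addTopRow (Over-transpose dom rs)) (cong (_ ∷_) (transpose-involutive rs))

-- Reading words

word : List (List ℕ) → List ℕ
word []      = []
word (c ∷ T) = word T ++ c

readingWord≡word : ∀ T → readingWord T ≡ word T
readingWord≡word [] = refl
readingWord≡word (c ∷ T) = begin
  concat (reverse (c ∷ T))          ≡⟨ cong concat (unfold-reverse c T) ⟩
  concat (reverse T ++ c ∷ [])      ≡⟨ concat-++ (reverse T) (c ∷ []) ⟨
  concat (reverse T) ++ c ++ []     ≡⟨ cong₂ _++_ (readingWord≡word T) (++-identityʳ c) ⟩
  word T ++ c                       ∎
  where open ≡-Reasoning

splitBy-concat : ∀ Ls → splitBy (map length Ls) (concat Ls) ≡ Ls
splitBy-concat []       = refl
splitBy-concat (l ∷ Ls) = cong₂ _∷_ (take-++-exact l) (trans (cong (splitBy (map length Ls)) (drop-++-exact l)) (splitBy-concat Ls))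
  where
  take-++-exact : ∀ (l : List ℕ) {w} → take (length l) (l ++ w) ≡ l
  take-++-exact []      = refl
  take-++-exact (x ∷ l) = cong (x ∷_) (take-++-exact l)
  drop-++-exact : ∀ (l : List ℕ) {w} → drop (length l) (l ++ w) ≡ w
  drop-++-exact []      = refl
  drop-++-exact (x ∷ l) = drop-++-exact l

withReadingWord-word : ∀ T T′ → map length T ≡ map length T′ → withReadingWord T (word T′) ≡ T′
withReadingWord-word T T′ eq = begin
  reverse (splitBy (map length (reverse T)) (word T′))
    ≡⟨ cong₂ (λ ns w → reverse (splitBy ns w)) lengths (sym (readingWord≡word T′)) ⟩
  reverse (splitBy (map length (reverse T′)) (concat (reverse T′)))
    ≡⟨ cong reverse (splitBy-concat (reverse T′)) ⟩
  reverse (reverse T′)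
    ≡⟨ reverse-involutive T′ ⟩
  T′ ∎
  where
  open ≡-Reasoning
  lengths : map length (reverse T) ≡ map length (reverse T′)
  lengths = begin
    map length (reverse T)   ≡⟨ reverse-map length T ⟩
    reverse (map length T)   ≡⟨ cong reverse eq ⟩
    reverse (map length T′)  ≡⟨ reverse-map length T′ ⟨
    map length (reverse T′)  ∎

-- Strictness of the two orders on distinct columns

BurgeSorted : Biword → Set
BurgeSorted = SortedList.Sorted (DecTotalOrder.totalOrder burgeOrder)

Unique-↭ : ∀ {V W : Biword} → V ↭ W → Unique V → Unique W
Unique-↭ p = PermSetoid.Unique-resp-↭ (setoid (ℕ × ℕ)) (↭⇒↭ₛ p)

burge-strict : ∀ {W} → BurgeSorted W → Unique W → AllPairs _≺_ W
burge-strict sorted unique =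
  AllPairs.zipWith strict (Linked⇒AllPairs (DecTotalOrder.trans burgeOrder) sorted , unique)
  where
  strict : ∀ {x y} → DecTotalOrder._≤_ burgeOrder x y × x ≢ y → x ≺ y
  strict (inj₁ (t≤ , t≢)  , _) = inj₁ (≤∧≢⇒< t≤ t≢)
  strict (inj₂ (refl , b≤) , ≢) = inj₂ (refl , ≤∧≢⇒< b≤ λ { refl → ≢ refl })

crystal-strict : ∀ {W} → Unique W → AllPairs _≻_ (toCrystal W)
crystal-strict {W} unique = AllPairs.zipWith strict
  ( Linked⇒AllPairs (DecTotalOrder.trans crystalOrder) (Sort.sort-↗ crystalOrder W)
  , Unique-↭ (↭-sym (Sort.sort-↭ crystalOrder W)) unique)
  where
  strict : ∀ {x y} → DecTotalOrder._≤_ crystalOrder x y × x ≢ y → x ≻ y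
  strict (inj₁ (b≤ , b≢)   , _) = inj₁ (≤∧≢⇒< b≤ (b≢ ∘ sym))
  strict (inj₂ (refl , t≤) , ≢) = inj₂ (refl , ≤∧≢⇒< t≤ λ { refl → ≢ refl })

≻⇒Unique : ∀ {C} → AllPairs _≻_ C → Unique C
≻⇒Unique = AllPairs.map ≻⇒≢
  where
  ≻⇒≢ : ∀ {x y} → x ≻ y → x ≢ y
  ≻⇒≢ (inj₁ p)       refl = <-irrefl refl p
  ≻⇒≢ (inj₂ (_ , p)) refl = <-irrefl refl p

tops : Biword → List ℕ
tops = map proj₁

-- Bracketings

module Crystal (i : ℕ) where

  data Letter : ℕ → Set where
    small   : ∀ {x} → x < i → Letter x
    closing : Letter i
    opening : Letter (suc i)
    large   : ∀ {x} → suc i < x → Letter x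

  letter : ∀ x → Letter x
  letter x with <-cmp x i
  ... | tri< x<i _ _ = small x<i
  ... | tri≈ _ refl _ = closing
  ... | tri> _ _ i<x with m≤n⇒m<n∨m≡n i<x
  ...   | inj₁ 1+i<x = large 1+i<x
  ...   | inj₂ refl  = opening

  -- The bicyclic monoid acts on ℕ: cl w n is the number of unmatched closing
  -- brackets of w )ⁿ, and op w n that of unmatched opening brackets of (ⁿ w.
  cl₁ op₁ : ℕ → ℕ → ℕ
  cl₁ x n with x ≟ i | x ≟ suc i
  ... | yes _ | _     = suc n
  ... | no _  | yes _ = pred n
  ... | no _  | no _  = n
  op₁ x n with x ≟ i | x ≟ suc i
  ... | yes _ | _     = pred n
  ... | no _  | yes _ = suc n
  ... | no _  | no _  = n

  cl op : List ℕ → ℕ → ℕ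
  cl []      n = n
  cl (x ∷ w) n = cl₁ x (cl w n)
  op []      n = n
  op (x ∷ w) n = op w (op₁ x n)

  cl₁-closing : ∀ n → cl₁ i n ≡ suc n
  cl₁-closing n with i ≟ i | i ≟ suc i
  ... | yes _ | _ = refl
  ... | no ¬p | _ = contradiction refl ¬p

  cl₁-opening : ∀ n → cl₁ (suc i) n ≡ pred n
  cl₁-opening n with suc i ≟ i | suc i ≟ suc i
  ... | yes p | _     = contradiction p 1+n≢n
  ... | no _  | yes _ = refl
  ... | no _  | no ¬p = contradiction refl ¬p

  op₁-closing : ∀ n → op₁ i n ≡ pred n
  op₁-closing n with i ≟ i | i ≟ suc i
  ... | yes _ | _ = refl
  ... | no ¬p | _ = contradiction refl ¬p

  op₁-opening : ∀ n → op₁ (suc i) n ≡ suc n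
  op₁-opening n with suc i ≟ i | suc i ≟ suc i
  ... | yes p | _     = contradiction p 1+n≢n
  ... | no _  | yes _ = refl
  ... | no _  | no ¬p = contradiction refl ¬p

  cl₁-neutral : ∀ {x} → x ≢ i → x ≢ suc i → ∀ n → cl₁ x n ≡ n
  cl₁-neutral {x} p q n with x ≟ i | x ≟ suc i
  ... | yes r | _     = contradiction r p
  ... | no _  | yes r = contradiction r q
  ... | no _  | no _  = refl

  op₁-neutral : ∀ {x} → x ≢ i → x ≢ suc i → ∀ n → op₁ x n ≡ n
  op₁-neutral {x} p q n with x ≟ i | x ≟ suc i
  ... | yes r | _     = contradiction r p
  ... | no _  | yes r = contradiction r q
  ... | no _  | no _  = refl

  cl₁-small : ∀ {x} → x < i → ∀ n → cl₁ x n ≡ n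
  cl₁-small x<i = cl₁-neutral (<⇒≢ x<i) (<⇒≢ (m<n⇒m<1+n x<i))

  cl₁-large : ∀ {x} → suc i < x → ∀ n → cl₁ x n ≡ n
  cl₁-large i<x = cl₁-neutral (>⇒≢ (<-trans (n<1+n i) i<x)) (>⇒≢ i<x)

  op₁-small : ∀ {x} → x < i → ∀ n → op₁ x n ≡ n
  op₁-small x<i = op₁-neutral (<⇒≢ x<i) (<⇒≢ (m<n⇒m<1+n x<i))

  op₁-large : ∀ {x} → suc i < x → ∀ n → op₁ x n ≡ n
  op₁-large i<x = op₁-neutral (>⇒≢ (<-trans (n<1+n i) i<x)) (>⇒≢ i<x)

  cl-large : ∀ {w} → All (suc i <_) w → ∀ n → cl w n ≡ n
  cl-large []      n = refl
  cl-large (p ∷ ps) n = trans (cl₁-large p _) (cl-large ps n)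

  op-large : ∀ {w} → All (suc i <_) w → ∀ n → op w n ≡ n
  op-large []       n = refl
  op-large {_ ∷ w} (p ∷ ps) n = trans (cong (op w) (op₁-large p n)) (op-large ps n)

  cl-++ : ∀ v w n → cl (v ++ w) n ≡ cl v (cl w n)
  cl-++ []      w n = refl
  cl-++ (x ∷ v) w n = cong (cl₁ x) (cl-++ v w n)

  op-++ : ∀ v w n → op (v ++ w) n ≡ op w (op v n)
  op-++ []      w n = refl
  op-++ (x ∷ v) w n = op-++ v w (op₁ x n)

  -- Cancelling turns `w` into `cl w 0` closing brackets followed by `op w 0` opening ones; the
  -- closing ones absorb that many of the `n` openings in front. `cl-normal` is the mirror image.
  op-normal : ∀ w n → op w n ≡ op w 0 + (n ∸ cl w 0)
  op-normal []      n = refl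
  op-normal (x ∷ w) n with letter x
  ... | small p rewrite op₁-small p n | op₁-small p 0 | cl₁-small p (cl w 0) = op-normal w n
  ... | large p rewrite op₁-large p n | op₁-large p 0 | cl₁-large p (cl w 0) = op-normal w n
  ... | closing rewrite op₁-closing n | op₁-closing 0 | cl₁-closing (cl w 0) =
    trans (op-normal w (pred n)) (cong (op w 0 +_) (pred-∸ n (cl w 0)))
    where
    pred-∸ : ∀ n k → pred n ∸ k ≡ n ∸ suc k
    pred-∸ zero    k = 0∸n≡0 k
    pred-∸ (suc n) k = refl
  ... | opening rewrite op₁-opening n | op₁-opening 0 | cl₁-opening (cl w 0)
                      | op-normal w (suc n) | op-normal w 1 with cl w 0
  ...   | zero  = sym (+-assoc (op w 0) 1 n)
  ...   | suc k rewrite 0∸n≡0 k | +-identityʳ (op w 0) = refl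

  cl-normal : ∀ w n → cl w n ≡ cl w 0 + (n ∸ op w 0)
  cl-normal []      n = refl
  cl-normal (x ∷ w) n with letter x
  ... | small p rewrite op₁-small p 0 | cl₁-small p (cl w 0) | cl₁-small p (cl w n) = cl-normal w n
  ... | large p rewrite op₁-large p 0 | cl₁-large p (cl w 0) | cl₁-large p (cl w n) = cl-normal w n
  ... | closing rewrite op₁-closing 0 | cl₁-closing (cl w 0) | cl₁-closing (cl w n) =
    cong suc (cl-normal w n)
  ... | opening rewrite op₁-opening 0 | cl₁-opening (cl w 0) | cl₁-opening (cl w n)
                      | cl-normal w n | op-normal w 1 with cl w 0
  ...   | suc k rewrite 0∸n≡0 k | +-identityʳ (op w 0) = refl
  ...   | zero  = trans (pred[m∸n]≡m∸[1+n] n (op w 0)) (cong (n ∸_) (+-comm 1 (op w 0)))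

  -- The action `cl` is faithful: its value at 0 gives the number of closing brackets of the reduced
  -- word, and the truncated differences give that of the opening ones. An equivalence proved for
  -- `cl` thus carries over to `op`.
  op-cong : ∀ v w → (∀ n → cl v n ≡ cl w n) → ∀ n → op v n ≡ op w n
  op-cong v w eq n = begin
    op v n                   ≡⟨ op-normal v n ⟩
    op v 0 + (n ∸ cl v 0)    ≡⟨ cong₂ (λ b a → b + (n ∸ a)) op≡ (eq 0) ⟩
    op w 0 + (n ∸ cl w 0)    ≡⟨ op-normal w n ⟨
    op w n                   ∎
    where
    open ≡-Reasoning
    ∸≡ : ∀ m → m ∸ op v 0 ≡ m ∸ op w 0
    ∸≡ m = +-cancelˡ-≡ (cl w 0) _ _ (begin
      cl w 0 + (m ∸ op v 0) ≡⟨ cong (_+ _) (eq 0) ⟨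
      cl v 0 + (m ∸ op v 0) ≡⟨ cl-normal v m ⟨
      cl v m                ≡⟨ eq m ⟩
      cl w m                ≡⟨ cl-normal w m ⟩
      cl w 0 + (m ∸ op w 0) ∎)
    op≡ : op v 0 ≡ op w 0
    op≡ = ≤-antisym
      (m∸n≡0⇒m≤n (trans (sym (∸≡ (op v 0))) (n∸n≡0 (op v 0))))
      (m∸n≡0⇒m≤n (trans (∸≡ (op w 0)) (n∸n≡0 (op w 0))))

  -- w′ arises from w = X (i + 1) D by changing the displayed letter to i; it
  -- is the leftmost unmatched i + 1 of (ʲ w, as X leaves none in (ʲ X and D
  -- leaves no unmatched i.
  data Raise : ℕ → List ℕ → List ℕ → Set where
    here  : ∀ {D} → cl D 0 ≡ 0 → Raise 0 (suc i ∷ D) (i ∷ D)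
    there : ∀ {j x w w′} → Raise (op₁ x j) w w′ → Raise j (x ∷ w) (x ∷ w′)

  -- All `j` openings have to be matched in front of the raised letter, by closing brackets that are
  -- unmatched within `w`.
  Raise-≤ : ∀ {j w w′} → Raise j w w′ → j ≤ cl w 0
  Raise-≤ (here _) = z≤n
  Raise-≤ {j} (there {x = x} r) with Raise-≤ r | letter x
  ... | h | small p rewrite op₁-small p j = ≤-trans h (≤-reflexive (sym (cl₁-small p _)))
  ... | h | large p rewrite op₁-large p j = ≤-trans h (≤-reflexive (sym (cl₁-large p _)))
  ... | h | closing rewrite op₁-closing j =
    ≤-trans (suc-pred-≤ j) (≤-trans (s≤s h) (≤-reflexive (sym (cl₁-closing _))))
    where
    suc-pred-≤ : ∀ j → j ≤ suc (pred j)
    suc-pred-≤ zero    = z≤n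
    suc-pred-≤ (suc _) = ≤-refl
  ... | h | opening rewrite op₁-opening j =
    ≤-trans (pred-mono-≤ h) (≤-reflexive (sym (cl₁-opening _)))

  Raise-cl : ∀ {j w w′} → Raise j w w′ → cl w′ 0 ≡ suc (cl w 0)
  Raise-cl (here {D} h) rewrite cl₁-closing (cl D 0) | cl₁-opening (cl D 0) | h = refl
  Raise-cl {j} (there {x = x} {w = w} {w′ = w′} r) rewrite Raise-cl r with Raise-≤ r | letter x
  ... | _ | small p rewrite cl₁-small p (cl w 0) | cl₁-small p (suc (cl w 0)) = refl
  ... | _ | large p rewrite cl₁-large p (cl w 0) | cl₁-large p (suc (cl w 0)) = refl
  ... | _ | closing rewrite cl₁-closing (cl w 0) | cl₁-closing (suc (cl w 0)) = refl
  ... | h | opening rewrite op₁-opening j | cl₁-opening (cl w 0) | cl₁-opening (suc (cl w 0)) with cl w 0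
  ...   | suc _ = refl

  -- All unmatched closing brackets of `w` lie in front of the raised letter, so they can absorb up
  -- to `cl w 0` openings. This is what allows a matched `i + 1` to be put in front of the word.
  Raise-lift : ∀ {k w w′} → Raise k w w′ → ∀ {j} → j ≤ cl w 0 → Raise j w w′
  Raise-lift (here {D} h) {j} j≤ rewrite cl₁-opening (cl D 0) | h with z≤n ← j≤ = here h
  Raise-lift {k} (there {x = x} {w = w} r) {j} j≤ = there (Raise-lift r (aux (letter x) (Raise-≤ r) j≤))
    where
    aux : ∀ {x} → Letter x → op₁ x k ≤ cl w 0 → j ≤ cl₁ x (cl w 0) → op₁ x j ≤ cl w 0
    aux (small p) h j≤ rewrite op₁-small p j | cl₁-small p (cl w 0) = j≤
    aux (large p) h j≤ rewrite op₁-large p j | cl₁-large p (cl w 0) = j≤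
    aux closing   h j≤ rewrite op₁-closing j | cl₁-closing (cl w 0) = pred-mono-≤ j≤
    aux opening   h j≤ rewrite op₁-opening k | op₁-opening j | cl₁-opening (cl w 0) with cl w 0 | h
    ... | suc m | _ = s≤s j≤

  Raise-++ : ∀ v {j w w′} → Raise (op v j) w w′ → Raise j (v ++ w) (v ++ w′)
  Raise-++ []      r = r
  Raise-++ (x ∷ v) r = there (Raise-++ v r)

  -- Comparison with the operators `e` and `f`

  Bracket : ℕ → Set
  Bracket n = Fin n × ℕ

  firstOpening lastClosing : ∀ {n} → List (Bracket n) → Maybe (Bracket n)
  firstOpening U = head (filter (λ (_ , x) → x ≟ suc i) U)
  lastClosing  U = last (filter (λ (_ , x) → x ≟ i) U)

  shift : ∀ {n} → Bracket n → Bracket (suc n)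
  shift (k , y) = suc k , y

  -- A list without matching pairs; the index counts its closing brackets, so it is 0 from the first
  -- opening one on.
  data Reduced {n} : ℕ → List (Bracket n) → Set where
    []    : Reduced 0 []
    open∷ : ∀ {k U} → Reduced 0 U → Reduced 0 ((k , suc i) ∷ U)
    close∷ : ∀ {m k U} → Reduced m U → Reduced (suc m) ((k , i) ∷ U)

  Reduced-shift : ∀ {n m} {U : List (Bracket n)} → Reduced m U → Reduced m (map shift U)
  Reduced-shift []         = []
  Reduced-shift (open∷ r)  = open∷ (Reduced-shift r)
  Reduced-shift (close∷ r) = close∷ (Reduced-shift r)

  firstOpening-shift : ∀ {n} (U : List (Bracket n)) →
                       firstOpening (map shift U) ≡ Maybe.map shift (firstOpening U)
  firstOpening-shift [] = refl
  firstOpening-shift ((k , y) ∷ U) with y ≡ᵇ suc i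
  ... | true  = refl
  ... | false = firstOpening-shift U

  firstOpening-open : ∀ {n} k (U : List (Bracket n)) → firstOpening ((k , suc i) ∷ U) ≡ just (k , suc i)
  firstOpening-open k U = cong head (filter-accept (λ (_ , x) → x ≟ suc i) refl)

  firstOpening-close : ∀ {n} k (U : List (Bracket n)) → firstOpening ((k , i) ∷ U) ≡ firstOpening U
  firstOpening-close k U = cong head (filter-reject (λ (_ , x) → x ≟ suc i) (≢-sym 1+n≢n))

  lastClosing-shift : ∀ {n} (U : List (Bracket n)) →
                      lastClosing (map shift U) ≡ Maybe.map shift (lastClosing U)
  lastClosing-shift U = trans (cong last (filter-shift U)) (last-map shift (filter (λ (_ , x) → x ≟ i) U))
    where
    filter-shift : ∀ {n} (U : List (Bracket n)) →
                   filter (λ (_ , x) → x ≟ i) (map shift U) ≡ map shift (filter (λ (_ , x) → x ≟ i) U)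
    filter-shift [] = refl
    filter-shift ((k , y) ∷ U) with y ≡ᵇ i
    ... | true  = cong (_ ∷_) (filter-shift U)
    ... | false = filter-shift U

  noClosing : ∀ {n} {U : List (Bracket n)} → Reduced 0 U → filter (λ (_ , x) → x ≟ i) U ≡ []
  noClosing []        = refl
  noClosing (open∷ r) = trans (filter-reject (λ (_ , x) → x ≟ i) 1+n≢n) (noClosing r)

  lastClosing-none : ∀ {n} {U : List (Bracket n)} → Reduced 0 U → lastClosing U ≡ nothing
  lastClosing-none r = cong last (noClosing r)

  lastClosing-single : ∀ {n k} {U : List (Bracket n)} → Reduced 0 U → lastClosing ((k , i) ∷ U) ≡ just (k , i)
  lastClosing-single r =
    cong last (trans (filter-accept (λ (_ , x) → x ≟ i) refl) (cong (_ ∷_) (noClosing r)))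

  lastClosing-∷ : ∀ {n m k} {U : List (Bracket n)} → Reduced (suc m) U →
                  lastClosing ((k , i) ∷ U) ≡ lastClosing U
  lastClosing-∷ (close∷ r) = trans
    (cong last (trans (filter-accept closing? refl) (cong (_ ∷_) (filter-accept closing? refl))))
    (sym (cong last (filter-accept closing? refl)))
    where
    closing? : ∀ {n} (p : Bracket n) → Dec (proj₂ p ≡ i)
    closing? (_ , x) = x ≟ i

  unmatched-neutral : ∀ {x} w → x ≢ i → x ≢ suc i → unmatched i (x ∷ w) ≡ map shift (unmatched i w)
  unmatched-neutral {x} w p q with x ≟ i | x ≟ suc i
  ... | yes r | _     = contradiction r p
  ... | no _  | yes r = contradiction r q
  ... | no _  | no _  = refl

  addBracket-closing : ∀ {n k} (U : List (Bracket n)) → addBracket i (k , i) U ≡ (k , i) ∷ U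
  addBracket-closing [] = refl
  addBracket-closing (q ∷ U) with i ≟ suc i | proj₂ q ≟ i
  ... | no _ | yes _ = refl
  ... | no _ | no _  = refl

  unmatched-closing : ∀ w → unmatched i (i ∷ w) ≡ (zero , i) ∷ map shift (unmatched i w)
  unmatched-closing w with i ≟ i | i ≟ suc i
  ... | no ¬p | _    = contradiction refl ¬p
  ... | yes _ | no _ = addBracket-closing _

  unmatched-opening : ∀ w → unmatched i (suc i ∷ w) ≡ addBracket i (zero , suc i) (map shift (unmatched i w))
  unmatched-opening w with suc i ≟ i | suc i ≟ suc i
  ... | yes p | _     = contradiction p 1+n≢n
  ... | no _  | no ¬p = contradiction refl ¬p
  ... | no _  | yes _ = refl

  addBracket-unpaired : ∀ {n k} {U : List (Bracket n)} → Reduced 0 U → addBracket i (k , suc i) U ≡ (k , suc i) ∷ U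
  addBracket-unpaired [] = refl
  addBracket-unpaired (open∷ r) with suc i ≟ suc i | suc i ≟ i
  ... | yes _ | yes p = contradiction p 1+n≢n
  ... | yes _ | no _  = refl
  ... | no _  | yes _ = refl
  ... | no _  | no _  = refl

  addBracket-paired : ∀ {n k l} (U : List (Bracket n)) → addBracket i (k , suc i) ((l , i) ∷ U) ≡ U
  addBracket-paired U with suc i ≟ suc i | i ≟ i
  ... | yes _ | yes _ = refl
  ... | no ¬p | _     = contradiction refl ¬p
  ... | yes _ | no ¬p = contradiction refl ¬p

  addBracket-Reduced : ∀ {n m k} {U : List (Bracket n)} → Reduced m U →
                       Reduced (pred m) (addBracket i (k , suc i) U)
  addBracket-Reduced {m = zero} r = subst (Reduced 0) (sym (addBracket-unpaired r)) (open∷ r)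
  addBracket-Reduced {k = k} (close∷ {k = l} {U} r) = subst (Reduced _) (sym (addBracket-paired {k = k} {l} U)) r

  unmatched-Reduced : ∀ w → Reduced (cl w 0) (unmatched i w)
  unmatched-Reduced [] = []
  unmatched-Reduced (x ∷ w) with letter x | Reduced-shift (unmatched-Reduced w)
  ... | small p | r rewrite unmatched-neutral w (<⇒≢ p) (<⇒≢ (m<n⇒m<1+n p)) | cl₁-small p (cl w 0) = r
  ... | large p | r rewrite unmatched-neutral w (>⇒≢ (<-trans (n<1+n i) p)) (>⇒≢ p) | cl₁-large p (cl w 0) = r
  ... | closing | r rewrite unmatched-closing w | cl₁-closing (cl w 0) = close∷ r
  ... | opening | r rewrite unmatched-opening w | cl₁-opening (cl w 0) = addBracket-Reduced r

  shifted-Reduced : ∀ {m} w → cl w 0 ≡ m → Reduced m (map shift (unmatched i w))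
  shifted-Reduced w refl = Reduced-shift (unmatched-Reduced w)

  onPosition : (w : List ℕ) → ℕ → Maybe (Bracket (length w)) → Maybe (List ℕ)
  onPosition w x = Maybe.map (λ (k , _) → w [ k ]∷= x)

  onPosition-shift : ∀ x w y p → onPosition (x ∷ w) y (Maybe.map shift p) ≡ Maybe.map (x ∷_) (onPosition w y p)
  onPosition-shift x w y (just _) = refl
  onPosition-shift x w y nothing  = refl

  e-skip : ∀ {x} w → firstOpening (unmatched i (x ∷ w)) ≡ firstOpening (map shift (unmatched i w)) →
           e i (x ∷ w) ≡ Maybe.map (x ∷_) (e i w)
  e-skip {x} w eq = begin
    onPosition (x ∷ w) i (firstOpening (unmatched i (x ∷ w)))
      ≡⟨ cong (onPosition (x ∷ w) i) (trans eq (firstOpening-shift (unmatched i w))) ⟩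
    onPosition (x ∷ w) i (Maybe.map shift (firstOpening (unmatched i w)))
      ≡⟨ onPosition-shift x w i (firstOpening (unmatched i w)) ⟩
    Maybe.map (x ∷_) (e i w) ∎
    where open ≡-Reasoning

  f-skip : ∀ {x} w → lastClosing (unmatched i (x ∷ w)) ≡ lastClosing (map shift (unmatched i w)) →
           f i (x ∷ w) ≡ Maybe.map (x ∷_) (f i w)
  f-skip {x} w eq = begin
    onPosition (x ∷ w) (suc i) (lastClosing (unmatched i (x ∷ w)))
      ≡⟨ cong (onPosition (x ∷ w) (suc i)) (trans eq (lastClosing-shift (unmatched i w))) ⟩
    onPosition (x ∷ w) (suc i) (Maybe.map shift (lastClosing (unmatched i w)))
      ≡⟨ onPosition-shift x w (suc i) (lastClosing (unmatched i w)) ⟩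
    Maybe.map (x ∷_) (f i w) ∎
    where open ≡-Reasoning

  e-neutral : ∀ {x} w → x ≢ i → x ≢ suc i → e i (x ∷ w) ≡ Maybe.map (x ∷_) (e i w)
  e-neutral w p q = e-skip w (cong firstOpening (unmatched-neutral w p q))

  f-neutral : ∀ {x} w → x ≢ i → x ≢ suc i → f i (x ∷ w) ≡ Maybe.map (x ∷_) (f i w)
  f-neutral w p q = f-skip w (cong lastClosing (unmatched-neutral w p q))

  e-closing : ∀ w → e i (i ∷ w) ≡ Maybe.map (i ∷_) (e i w)
  e-closing w = e-skip w (trans (cong firstOpening (unmatched-closing w)) (firstOpening-close zero (map shift (unmatched i w))))

  e-unpaired : ∀ w → cl w 0 ≡ 0 → e i (suc i ∷ w) ≡ just (i ∷ w)
  e-unpaired w eq = cong (onPosition (suc i ∷ w) i) (trans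
    (cong firstOpening (trans (unmatched-opening w)
      (addBracket-unpaired (shifted-Reduced w eq))))
    (firstOpening-open zero (map shift (unmatched i w))))

  addBracket-firstOpening : ∀ {n m k} {U : List (Bracket n)} → Reduced (suc m) U →
                            firstOpening (addBracket i (k , suc i) U) ≡ firstOpening U
  addBracket-firstOpening {k = k} (close∷ {k = l} {U} _) =
    trans (cong firstOpening (addBracket-paired {k = k} {l} U)) (sym (firstOpening-close l U))

  addBracket-lastClosing : ∀ {n m k} {U : List (Bracket n)} → Reduced (suc (suc m)) U →
                           lastClosing (addBracket i (k , suc i) U) ≡ lastClosing U
  addBracket-lastClosing {k = k} (close∷ {k = l} {U} r) =
    trans (cong lastClosing (addBracket-paired {k = k} {l} U)) (sym (lastClosing-∷ r))

  e-paired : ∀ {m} w → cl w 0 ≡ suc m → e i (suc i ∷ w) ≡ Maybe.map (suc i ∷_) (e i w)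
  e-paired w eq = e-skip w (trans (cong firstOpening (unmatched-opening w))
    (addBracket-firstOpening (shifted-Reduced w eq)))

  f-unpaired : ∀ w → cl w 0 ≡ 0 → f i (i ∷ w) ≡ just (suc i ∷ w)
  f-unpaired w eq = cong (onPosition (i ∷ w) (suc i)) (trans
    (cong lastClosing (unmatched-closing w))
    (lastClosing-single (shifted-Reduced w eq)))

  f-closing : ∀ {m} w → cl w 0 ≡ suc m → f i (i ∷ w) ≡ Maybe.map (i ∷_) (f i w)
  f-closing w eq = f-skip w (trans (cong lastClosing (unmatched-closing w))
    (lastClosing-∷ (shifted-Reduced w eq)))

  -- The opening in front cancels the leftmost unmatched `i`, whereas `f` wants the rightmost; one
  -- remains only if there were two, as in `f-paired`.
  f-none : ∀ w → cl w 0 ≤ 1 → f i (suc i ∷ w) ≡ nothing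
  f-none w h = cong (onPosition (suc i ∷ w) (suc i)) (lastClosing-none
    (subst (λ m → Reduced m (unmatched i (suc i ∷ w)))
      (trans (cl₁-opening (cl w 0)) (n≤0⇒n≡0 (pred-mono-≤ h))) (unmatched-Reduced (suc i ∷ w))))

  f-paired : ∀ {m} w → cl w 0 ≡ suc (suc m) → f i (suc i ∷ w) ≡ Maybe.map (suc i ∷_) (f i w)
  f-paired w eq = f-skip w (trans (cong lastClosing (unmatched-opening w))
    (addBracket-lastClosing (shifted-Reduced w eq)))

  Raise⇒e : ∀ {j w w′} → Raise j w w′ → e i w ≡ just w′
  Raise⇒e (here {D} h) = e-unpaired D h
  Raise⇒e {j} (there {x = x} {w} r) with letter x | Raise-≤ r
  ... | small p | _ rewrite e-neutral w (<⇒≢ p) (<⇒≢ (m<n⇒m<1+n p)) | Raise⇒e r = refl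
  ... | large p | _ rewrite e-neutral w (>⇒≢ (<-trans (n<1+n i) p)) (>⇒≢ p) | Raise⇒e r = refl
  ... | closing | _ rewrite e-closing w | Raise⇒e r = refl
  ... | opening | h rewrite op₁-opening j with cl w 0 in eq
  ...   | suc m rewrite e-paired w eq | Raise⇒e r = refl

  Raise⇒f : ∀ {j w w′} → Raise j w w′ → f i w′ ≡ just w
  Raise⇒f (here {D} h) = f-unpaired D h
  Raise⇒f {j} (there {x = x} {w} {w′} r) with letter x | Raise-≤ r
  ... | small p | _ rewrite f-neutral w′ (<⇒≢ p) (<⇒≢ (m<n⇒m<1+n p)) | Raise⇒f r = refl
  ... | large p | _ rewrite f-neutral w′ (>⇒≢ (<-trans (n<1+n i) p)) (>⇒≢ p) | Raise⇒f r = refl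
  ... | closing | _ rewrite f-closing w′ (Raise-cl r) | Raise⇒f r = refl
  ... | opening | h rewrite op₁-opening j with cl w 0 in eq
  ...   | suc m rewrite f-paired w′ (trans (Raise-cl r) (cong suc eq)) | Raise⇒f r = refl

  map-∷-just : ∀ (x : ℕ) (m : Maybe (List ℕ)) {w′ : List ℕ} → Maybe.map (x ∷_) m ≡ just w′ → ∃[ v ] m ≡ just v × w′ ≡ x ∷ v
  map-∷-just x (just v) refl = v , refl , refl

  e⇒Raise : ∀ w {w′} → e i w ≡ just w′ → Raise 0 w w′
  e⇒Raise (x ∷ w) {w′} eq with letter x
  ... | small p
    with v , eq′ , refl ← map-∷-just x (e i w) (trans (sym (e-neutral w (<⇒≢ p) (<⇒≢ (m<n⇒m<1+n p)))) eq)
    = there (subst (λ j → Raise j w v) (sym (op₁-small p 0)) (e⇒Raise w eq′))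
  ... | large p
    with v , eq′ , refl ← map-∷-just x (e i w) (trans (sym (e-neutral w (>⇒≢ (<-trans (n<1+n i) p)) (>⇒≢ p))) eq)
    = there (subst (λ j → Raise j w v) (sym (op₁-large p 0)) (e⇒Raise w eq′))
  ... | closing
    with v , eq′ , refl ← map-∷-just i (e i w) (trans (sym (e-closing w)) eq)
    = there (subst (λ j → Raise j w v) (sym (op₁-closing 0)) (e⇒Raise w eq′))
  ... | opening with cl w 0 in h
  ...   | zero with refl ← trans (sym (e-unpaired w h)) eq = here h
  ...   | suc m
    with v , eq′ , refl ← map-∷-just (suc i) (e i w) (trans (sym (e-paired w h)) eq)
    = there (subst (λ j → Raise j w v) (sym (op₁-opening 0))
        (Raise-lift (e⇒Raise w eq′) (≤-trans (s≤s z≤n) (≤-reflexive (sym h)))))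

  f⇒Raise : ∀ w′ {w} → f i w′ ≡ just w → Raise 0 w w′
  f⇒Raise (x ∷ w′) eq with letter x
  ... | small p
    with v , eq′ , refl ← map-∷-just x (f i w′) (trans (sym (f-neutral w′ (<⇒≢ p) (<⇒≢ (m<n⇒m<1+n p)))) eq)
    = there (subst (λ j → Raise j v w′) (sym (op₁-small p 0)) (f⇒Raise w′ eq′))
  ... | large p
    with v , eq′ , refl ← map-∷-just x (f i w′) (trans (sym (f-neutral w′ (>⇒≢ (<-trans (n<1+n i) p)) (>⇒≢ p))) eq)
    = there (subst (λ j → Raise j v w′) (sym (op₁-large p 0)) (f⇒Raise w′ eq′))
  f⇒Raise (x ∷ w′) eq | closing with cl w′ 0 in h
  ...   | zero with refl ← trans (sym (f-unpaired w′ h)) eq = here h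
  ...   | suc m
    with v , eq′ , refl ← map-∷-just i (f i w′) (trans (sym (f-closing w′ h)) eq)
    = there (subst (λ j → Raise j v w′) (sym (op₁-closing 0)) (f⇒Raise w′ eq′))
  f⇒Raise (x ∷ w′) eq | opening with cl w′ 0 in h
  ...   | zero with () ← trans (sym (f-none w′ (≤-trans (≤-reflexive h) z≤n))) eq
  ...   | suc zero with () ← trans (sym (f-none w′ (≤-reflexive h))) eq
  ...   | suc (suc m)
    with v , eq′ , refl ← map-∷-just (suc i) (f i w′) (trans (sym (f-paired w′ h)) eq)
    = there (subst (λ j → Raise j v w′) (sym (op₁-opening 0))
        (Raise-lift r (≤-trans (s≤s z≤n) (≤-reflexive (sym (suc-injective (trans (sym (Raise-cl r)) h)))))))
    where r = f⇒Raise w′ eq′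

  -- Crystal operators and dual insertion

  -- Rows are read from right to left, tableaux by rows from top to bottom.
  clR opR : List ℕ → ℕ → ℕ
  clR []      n = n
  clR (x ∷ R) n = clR R (cl₁ x n)
  opR []      n = n
  opR (x ∷ R) n = op₁ x (opR R n)

  clT : Tableau → ℕ → ℕ
  clT []      n = n
  clT (R ∷ Q) n = clR R (clT Q n)

  clR-∷ʳ : ∀ R t n → clR (R ∷ʳ t) n ≡ cl₁ t (clR R n)
  clR-∷ʳ []      t n = refl
  clR-∷ʳ (x ∷ R) t n = clR-∷ʳ R t (cl₁ x n)

  opR-∷ʳ : ∀ R t n → opR (R ∷ʳ t) n ≡ opR R (op₁ t n)
  opR-∷ʳ []      t n = refl
  opR-∷ʳ (x ∷ R) t n = cong (op₁ x) (opR-∷ʳ R t n)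

  clR-small : ∀ {R} → All (_< i) R → ∀ n → clR R n ≡ n
  clR-small []       n = refl
  clR-small {_ ∷ R} (p ∷ ps) n = trans (cong (clR R) (cl₁-small p n)) (clR-small ps n)

  clR-large : ∀ {R} → All (suc i <_) R → ∀ n → clR R n ≡ n
  clR-large []       n = refl
  clR-large {_ ∷ R} (p ∷ ps) n = trans (cong (clR R) (cl₁-large p n)) (clR-large ps n)

  opR-large : ∀ {R} → All (suc i <_) R → ∀ n → opR R n ≡ n
  opR-large []       n = refl
  opR-large (p ∷ ps) n = trans (op₁-large p _) (opR-large ps n)

  above : ∀ {y ys} → suc i ≤ y → All (y <_) ys → All (suc i <_) ys
  above h = All.map (≤-<-trans h)

  clR-above : ∀ {R} → Increasing R → All (i <_) R → (∀ n → clR R n ≡ n) ⊎ (∀ n → clR R n ≡ pred n)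
  clR-above [] [] = inj₁ λ _ → refl
  clR-above {x ∷ R} (x< ∷ _) (i<x ∷ _) with R-large ← above i<x x< | letter x
  ... | small x<i = contradiction x<i (<-asym i<x)
  ... | closing   = contradiction i<x (<-irrefl refl)
  ... | opening   = inj₂ λ n → trans (clR-large R-large _) (cl₁-opening n)
  ... | large p   = inj₁ λ n → trans (clR-large R-large _) (cl₁-large p n)

  opR-above : ∀ {R} → Increasing R → All (i <_) R → (∀ n → opR R n ≡ n) ⊎ (∀ n → opR R n ≡ suc n)
  opR-above [] [] = inj₁ λ _ → refl
  opR-above {x ∷ R} (x< ∷ _) (i<x ∷ _) with R-large ← above i<x x< | letter x
  ... | small x<i = contradiction x<i (<-asym i<x)
  ... | closing   = contradiction i<x (<-irrefl refl)
  ... | opening   = inj₂ λ n → trans (op₁-opening _) (cong suc (opR-large R-large n))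
  ... | large p   = inj₁ λ n → trans (op₁-large p _) (opR-large R-large n)

  Bump-opening : ∀ {R R′ y} → Bump (suc i) R R′ y → All (i <_) R → ∃[ H ] R ≡ y ∷ H × R′ ≡ suc i ∷ H
  Bump-opening (here _)        _         = -, refl , refl
  Bump-opening (there x<1+i _) (i<x ∷ _) = contradiction i<x (<⇒≱ x<1+i)

  -- In the bicyclic monoid, `t` followed by `R` equals `R′` followed by `y`. Brackets change their
  -- order only in two cases: an `i` bumping an `i` that has an `i + 1` behind it, which is ")()" =
  -- "())", and an `i + 1` bumping an `i + 1` that has an `i` before it, which is "(()" = "()(".
  -- These are the Knuth relations in two letters.
  Bump-cl : ∀ {t R R′ y} → Increasing R → Bump t R R′ y → ∀ n → cl₁ t (clR R n) ≡ clR R′ (cl₁ y n)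
  Bump-cl {t} (y< ∷ inc) (here {y} {ys} t≤y) n with letter t
  ... | small p rewrite cl₁-small p (clR ys (cl₁ y n)) | cl₁-small p (cl₁ y n) = refl
  ... | large p rewrite cl₁-large p (clR ys (cl₁ y n)) | cl₁-large p (cl₁ y n) = refl
  ... | opening rewrite clR-large (above t≤y y<) (cl₁ y n) | clR-large (above t≤y y<) (cl₁ (suc i) (cl₁ y n)) = refl
  ... | closing with m≤n⇒m<n∨m≡n t≤y
  ...   | inj₁ i<y rewrite clR-large (above i<y y<) (cl₁ y n) | clR-large (above i<y y<) (cl₁ i (cl₁ y n)) = refl
  ...   | inj₂ refl rewrite cl₁-closing n | cl₁-closing (suc n) with clR-above inc y<
  ...     | inj₁ eq rewrite eq (suc n) | eq (suc (suc n)) = cl₁-closing _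
  ...     | inj₂ eq rewrite eq (suc n) | eq (suc (suc n)) = cl₁-closing _
  Bump-cl {t} (x< ∷ inc) (there {x} {R} {R′} {y} x<t b) n
    with Bump-cl inc b (cl₁ x n) | letter x | <-≤-trans x<t (Bump-≥ b)
  ... | eq | small p | _ rewrite cl₁-small p n | cl₁-small p (cl₁ y n) = eq
  ... | eq | large p | _ rewrite cl₁-large p n | cl₁-large p (cl₁ y n) = eq
  ... | eq | opening | p rewrite cl₁-large p n | cl₁-large p (cl₁ (suc i) n) = eq
  ... | eq | closing | i<y with m≤n⇒m<n∨m≡n i<y
  ...   | inj₁ p rewrite cl₁-large p n | cl₁-large p (cl₁ i n) = eq
  ...   | inj₂ refl with refl ← ≤-antisym x<t (Bump-≥ b) with H , refl , refl ← Bump-opening b x<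
    with H-large ← AllPairs.head inc = trans eq (begin
      clR H (cl₁ (suc i) (cl₁ (suc i) (cl₁ i n)))  ≡⟨ clR-large H-large _ ⟩
      cl₁ (suc i) (cl₁ (suc i) (cl₁ i n))          ≡⟨ cong (λ m → cl₁ (suc i) (cl₁ (suc i) m)) (cl₁-closing n) ⟩
      cl₁ (suc i) (cl₁ (suc i) (suc n))            ≡⟨ cong (cl₁ (suc i)) (cl₁-opening (suc n)) ⟩
      cl₁ (suc i) n                                ≡⟨ cl₁-opening n ⟩
      pred n                                       ≡⟨ cl₁-opening (suc (pred n)) ⟨
      cl₁ (suc i) (suc (pred n))                   ≡⟨ cong (cl₁ (suc i)) (cl₁-closing (pred n)) ⟨
      cl₁ (suc i) (cl₁ i (pred n))                 ≡⟨ cong (λ m → cl₁ (suc i) (cl₁ i m)) (cl₁-opening n) ⟨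
      cl₁ (suc i) (cl₁ i (cl₁ (suc i) n))          ≡⟨ clR-large H-large _ ⟨
      clR H (cl₁ (suc i) (cl₁ i (cl₁ (suc i) n)))  ∎)
    where open ≡-Reasoning

  Bump-op : ∀ {t R R′ y} → Increasing R → Bump t R R′ y → ∀ n → opR R (op₁ t n) ≡ op₁ y (opR R′ n)
  Bump-op {t} (y< ∷ inc) (here {y} {ys} t≤y) n with letter t
  ... | small p rewrite op₁-small p n | op₁-small p (opR ys n) = refl
  ... | large p rewrite op₁-large p n | op₁-large p (opR ys n) = refl
  ... | opening rewrite opR-large (above t≤y y<) (op₁ (suc i) n) | opR-large (above t≤y y<) n = refl
  ... | closing with m≤n⇒m<n∨m≡n t≤y
  ...   | inj₁ i<y rewrite opR-large (above i<y y<) (op₁ i n) | opR-large (above i<y y<) n = refl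
  ...   | inj₂ refl rewrite op₁-closing n with opR-above inc y<
  ...     | inj₁ eq rewrite eq (pred n) | eq n | op₁-closing n = refl
  ...     | inj₂ eq rewrite eq (pred n) | eq n | op₁-closing (suc n) =
    trans (op₁-closing (suc (pred n))) (sym (op₁-closing n))
  Bump-op {t} (x< ∷ inc) (there {x} {R} {R′} {y} x<t b) n
    with Bump-op inc b n | letter x | <-≤-trans x<t (Bump-≥ b)
  ... | eq | small p | _ rewrite op₁-small p (opR R (op₁ t n)) | op₁-small p (opR R′ n) = eq
  ... | eq | large p | _ rewrite op₁-large p (opR R (op₁ t n)) | op₁-large p (opR R′ n) = eq
  ... | eq | opening | p rewrite eq | op₁-large p (opR R′ n) | op₁-large p (op₁ (suc i) (opR R′ n)) = refl
  ... | eq | closing | i<y with m≤n⇒m<n∨m≡n i<y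
  ...   | inj₁ p rewrite eq | op₁-large p (opR R′ n) | op₁-large p (op₁ i (opR R′ n)) = refl
  ...   | inj₂ refl with refl ← ≤-antisym x<t (Bump-≥ b) with H , refl , refl ← Bump-opening b x<
    with H-large ← AllPairs.head inc
    rewrite opR-large H-large n | opR-large H-large (op₁ (suc i) n) | op₁-opening n
          | op₁-opening (suc n) | op₁-closing (suc (suc n)) | op₁-closing (suc n) = sym (op₁-opening n)

  Pass-cl : ∀ {C R p o} → Pass C R p o → ∀ n → cl (tops C) n ≡ clR R (cl (tops o) n)
  Pass-cl []                                  n = refl
  Pass-cl (append {t} {R = R} {o = o} q _)    n =
    trans (cong (cl₁ t) (Pass-cl q n)) (sym (clR-∷ʳ R t (cl (tops o) n)))
  Pass-cl (bump {t} {o = o} q b)              n =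
    trans (cong (cl₁ t) (Pass-cl q n)) (Bump-cl (Pass-increasing q) b (cl (tops o) n))

  Dual-cl : ∀ {C P Q} → Dual C P Q → ∀ n → cl (tops C) n ≡ clT Q n
  Dual-cl []                   n = refl
  Dual-cl (pass {R = R} q d) n = trans (Pass-cl q n) (cong (clR R) (Dual-cl d n))

  data RaiseTop : ℕ → Biword → Biword → Set where
    here  : ∀ {b D} → cl (tops D) 0 ≡ 0 → RaiseTop 0 ((suc i , b) ∷ D) ((i , b) ∷ D)
    there : ∀ {j t b C C′} → RaiseTop (op₁ t j) C C′ → RaiseTop j ((t , b) ∷ C) ((t , b) ∷ C′)

  -- The changed letter is the only bracket of the row: an `i` is excluded, which keeps the raised
  -- row strictly increasing.
  data RaiseRow : List ℕ → List ℕ → Set where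
    here  : ∀ {H} → All (suc i <_) H → RaiseRow (suc i ∷ H) (i ∷ H)
    there : ∀ {x R R′} → x < i → RaiseRow R R′ → RaiseRow (x ∷ R) (x ∷ R′)

  data RaiseTableau : ℕ → Tableau → Tableau → Set where
    here  : ∀ {R R′ Q} → RaiseRow R R′ → clT Q 0 ≡ 0 → RaiseTableau 0 (R ∷ Q) (R′ ∷ Q)
    there : ∀ {j R Q Q′} → RaiseTableau (opR R j) Q Q′ → RaiseTableau j (R ∷ Q) (R ∷ Q′)

  data RaisePass (j : ℕ) (R R′ : List ℕ) (o o′ : Biword) : Set where
    inRow  : j ≡ 0 → RaiseRow R R′ → o ≡ o′ → cl (tops o) 0 ≡ 0 → RaisePass j R R′ o o′
    inRest : R ≡ R′ → RaiseTop (opR R j) o o′ → RaisePass j R R′ o o′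

  -- An `i` could only be the last entry, which is read first, so nothing in the row could match it.
  closing-free : ∀ {R m} → Increasing R → All (_< suc i) R → clR R m ≡ 0 → All (_< i) R
  closing-free [] [] _ = []
  closing-free {x ∷ R} {m} (x< ∷ inc) (x<1+i ∷ R<1+i) eq with m≤n⇒m<n∨m≡n (≤-pred x<1+i)
  ... | inj₁ x<i rewrite cl₁-small x<i m = x<i ∷ closing-free inc R<1+i eq
  ... | inj₂ refl with R | x< | R<1+i
  ...   | []    | _       | _          with () ← trans (sym (cl₁-closing m)) eq
  ...   | _ ∷ _ | i<y ∷ _ | y<1+i ∷ _ = contradiction i<y (<⇒≱ y<1+i)

  RaiseRow-∷ʳ : ∀ {R} → All (_< i) R → RaiseRow (R ∷ʳ suc i) (R ∷ʳ i)
  RaiseRow-∷ʳ []       = here []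
  RaiseRow-∷ʳ (p ∷ ps) = there p (RaiseRow-∷ʳ ps)

  data RaiseBump (j m : ℕ) (R₁ R₁′ : List ℕ) (y y′ : ℕ) : Set where
    inRow  : RaiseRow R₁ R₁′ → y ≡ y′ → j ≡ 0 → cl₁ y m ≡ 0 → RaiseBump j m R₁ R₁′ y y′
    bumped : R₁ ≡ R₁′ → y ≡ suc i → y′ ≡ i → m ≡ 0 → opR R₁ j ≡ 0 → RaiseBump j m R₁ R₁′ y y′

  RaiseBump-∷ : ∀ {x j m R₁ R₁′ y y′} → x < i → RaiseBump j m R₁ R₁′ y y′ → RaiseBump j m (x ∷ R₁) (x ∷ R₁′) y y′
  RaiseBump-∷ x<i (inRow r y≡ j≡ m≡)       = inRow (there x<i r) y≡ j≡ m≡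
  RaiseBump-∷ x<i (bumped refl y≡ y′≡ m≡ op≡) = bumped refl y≡ y′≡ m≡ (trans (op₁-small x<i _) op≡)

  -- If `R` contains no `i`, then `i` and `i + 1` bump the same entry. If it contains both, each
  -- bumps its equal: the row stays as it is and the difference passes to the bumped letter. An `i`
  -- without `i + 1` in `R` would remain unmatched, against the hypothesis.
  raise-letter : ∀ {R R₁ y m} → Increasing R → Bump (suc i) R R₁ y → clR R m ≡ 0 →
                 ∃₂ λ R₁′ y′ → Bump i R R₁′ y′ × RaiseBump 0 m R₁ R₁′ y y′
  raise-letter {m = m} (y< ∷ _) (here {y} 1+i≤y) eq =
    -, -, here (<⇒≤ 1+i≤y) ,
    inRow (here (above 1+i≤y y<)) refl refl (trans (sym (clR-large (above 1+i≤y y<) (cl₁ y m))) eq)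
  raise-letter {m = m} (x< ∷ inc) (there {x} {R} x<1+i b) eq with m≤n⇒m<n∨m≡n (≤-pred x<1+i)
  ... | inj₁ x<i with _ , _ , b′ , r ← raise-letter inc b (trans (cong (clR R) (sym (cl₁-small x<i m))) eq) =
    -, -, there x<i b′ , RaiseBump-∷ x<i r
  ... | inj₂ refl with H , refl , refl ← Bump-opening b x< with m≤n⇒m<n∨m≡n (Bump-≥ b)
  ...   | inj₁ p with () ← trans (sym (cl₁-closing m)) (trans (sym (cl₁-large p (cl₁ i m)))
                            (trans (sym (clR-large (above (<⇒≤ p) (AllPairs.head inc)) _)) eq))
  ...   | inj₂ refl = -, -, here ≤-refl , bumped refl refl refl m≡0 op≡0
    where
    H-large = AllPairs.head inc
    m≡0 : m ≡ 0
    m≡0 = begin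
      m                              ≡⟨ cl₁-opening (suc m) ⟨
      cl₁ (suc i) (suc m)            ≡⟨ cong (cl₁ (suc i)) (cl₁-closing m) ⟨
      cl₁ (suc i) (cl₁ i m)          ≡⟨ clR-large H-large _ ⟨
      clR H (cl₁ (suc i) (cl₁ i m))  ≡⟨ eq ⟩
      0                              ∎
      where open ≡-Reasoning
    op≡0 : op₁ i (op₁ (suc i) (opR H 0)) ≡ 0
    op≡0 rewrite opR-large H-large 0 | op₁-opening 0 = op₁-closing 1

  -- The only letter that could tell `i` from `i + 1` is `t = i + 1`, and it is excluded because no
  -- opening may be left over in front of the raised letter. A `t` that hits the raised entry sends
  -- it to the next row and makes the two rows equal.
  raise-bump : ∀ {t j m R R′ R₁ y} → RaiseRow R R′ → Bump t R R₁ y → op₁ t j ≡ 0 → m ≡ 0 →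
               ∃₂ λ R₁′ y′ → Bump t R′ R₁′ y′ × RaiseBump j m R₁ R₁′ y y′
  raise-bump {t} {j} (here {H} p) (here t≤1+i) eq m≡ with m≤n⇒m<n∨m≡n t≤1+i
  ... | inj₂ refl with () ← trans (sym (op₁-opening j)) eq
  ... | inj₁ t<1+i =
    -, -, here (≤-pred t<1+i) , bumped refl refl refl m≡ (trans (cong (op₁ t) (opR-large p j)) eq)
  raise-bump {t} {j} (here p) (there 1+i<t b) eq refl with R₁-large , y-large ← Bump-All 1+i<t p b =
    -, -, there (<-trans (n<1+n i) 1+i<t) b ,
    inRow (here R₁-large) refl (trans (sym (op₁-large 1+i<t j)) eq) (cl₁-large y-large 0)
  raise-bump {j = j} (there x<i r) (here t≤x) eq refl =
    -, -, here t≤x ,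
    inRow (there (≤-<-trans t≤x x<i) r) refl (trans (sym (op₁-small (≤-<-trans t≤x x<i) j)) eq) (cl₁-small x<i 0)
  raise-bump (there x<i r) (there x<t b) eq m≡ with _ , _ , b′ , h ← raise-bump r b eq m≡ =
    -, -, there x<t b′ , RaiseBump-∷ x<i h

  raise-append : ∀ {t j R R′} → RaiseRow R R′ → All (_< t) R → op₁ t j ≡ 0 →
                 RaiseRow (R ∷ʳ t) (R′ ∷ʳ t) × All (_< t) R′ × j ≡ 0
  raise-append {j = j} (here p) (1+i<t ∷ H<t) eq =
    here (∷ʳ⁺ p 1+i<t) , <-trans (n<1+n i) 1+i<t ∷ H<t , trans (sym (op₁-large 1+i<t j)) eq
  raise-append (there x<i r) (x<t ∷ R<t) eq with r′ , R′<t , j≡0 ← raise-append r R<t eq =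
    there x<i r′ , x<t ∷ R′<t , j≡0

  RaiseBump⇒RaisePass : ∀ {j b R₁ R₁′ y y′ o} → RaiseBump j (cl (tops o) 0) R₁ R₁′ y y′ →
                        RaisePass j R₁ R₁′ ((y , b) ∷ o) ((y′ , b) ∷ o)
  RaiseBump⇒RaisePass (inRow r refl j≡ m≡) = inRow j≡ r refl m≡
  RaiseBump⇒RaisePass (bumped refl refl refl m≡ op≡) =
    inRest refl (subst (λ j → RaiseTop j _ _) (sym op≡) (here m≡))

  -- The common `p` is the invariance of the insertion tableau. The two runs differ in one letter,
  -- in the row or in the output; once it has left the row, the rows agree for good.
  raisePass : ∀ {j C C′ R p o} → RaiseTop j C C′ → Pass C R p o →
              ∃₂ λ R′ o′ → Pass C′ R′ p o′ × RaisePass j R R′ o o′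
  raisePass (here {D = D} eq) (append {R = R} {o = o} q R<1+i)
    with R<i ← closing-free (Pass-increasing q) R<1+i (trans (sym (Pass-cl q 0)) eq) =
    -, -, append q R<i ,
    inRow refl (RaiseRow-∷ʳ R<i) refl (trans (sym (clR-small R<i _)) (trans (sym (Pass-cl q 0)) eq))
  raisePass (here eq) (bump q b)
    with _ , _ , b′ , h ← raise-letter (Pass-increasing q) b (trans (sym (Pass-cl q 0)) eq) =
    -, -, bump q b′ , RaiseBump⇒RaisePass h
  raisePass {j} (there r) (append {t} {R = R} q R<t) with raisePass r q
  ... | _ , _ , q′ , inRow eq s refl m≡ with s′ , R′<t , j≡0 ← raise-append s R<t eq =
    -, -, append q′ R′<t , inRow j≡0 s′ refl m≡
  ... | _ , _ , q′ , inRest refl s =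
    -, -, append q′ R<t , inRest refl (subst (λ j → RaiseTop j _ _) (sym (opR-∷ʳ R t j)) s)
  raisePass {j} (there r) (bump q b) with raisePass r q
  ... | _ , _ , q′ , inRow eq s refl m≡ with _ , _ , b′ , h ← raise-bump s b eq m≡ =
    -, -, bump q′ b′ , RaiseBump⇒RaisePass h
  ... | _ , _ , q′ , inRest refl s =
    -, -, bump q′ b , inRest refl (there (subst (λ j → RaiseTop j _ _) (Bump-op (Pass-increasing q) b j) s))

  pass-raised : ∀ {j C C′ R p o P Q} → RaiseTop j C C′ → Pass C′ R p o → Dual o P Q → Dual C′ (p ∷ P) (R ∷ Q)
  pass-raised (here _)  = pass
  pass-raised (there _) = pass

  raiseDual : ∀ {j C C′ P Q} → RaiseTop j C C′ → Dual C P Q →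
              ∃[ Q′ ] Dual C′ P Q′ × RaiseTableau j Q Q′
  raiseDual r (pass q d) with raisePass r q
  ... | _ , _ , q′ , inRow refl s refl eq = -, pass-raised r q′ d , here s (trans (sym (Dual-cl d 0)) eq)
  ... | _ , _ , q′ , inRest refl s with _ , d′ , s′ ← raiseDual s d = -, pass-raised r q′ d′ , there s′

  -- Crystal operators on transposed tableaux

  -- Entries above i + 1 are irrelevant here, so strictness of c < d is
  -- only required down to the last i + 1 of d.
  data _◁_ : List ℕ → List ℕ → Set where
    stop : ∀ {c d} → All (suc i <_) d → c ◁ d
    _∷_  : ∀ {y z c d} → y < z → c ◁ d → (y ∷ c) ◁ (z ∷ d)

  data _◁ʰ_ (c : List ℕ) : List (List ℕ) → Set where
    []  : c ◁ʰ []
    [_] : ∀ {d T} → c ◁ d → c ◁ʰ (d ∷ T)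

  data Rows : List (List ℕ) → Set where
    []     : Rows []
    addRow : ∀ {c T} → AllPairs _≤_ c → c ◁ʰ T → Rows T → Rows (c ∷ T)

  ◁ʰ-addTopRow : ∀ {x q c T} → All (x <_) q → c ◁ʰ T → Over q T → (x ∷ c) ◁ʰ addTopRow q T
  ◁ʰ-addTopRow []        _     []      = []
  ◁ʰ-addTopRow (x<y ∷ _) _     []      = [ x<y ∷ stop [] ]
  ◁ʰ-addTopRow (x<y ∷ _) [ h ] (_ ∷ _) = [ x<y ∷ h ]

  Rows-addTopRow : ∀ {q T} → Increasing q → Over q T → Rows T → Rows (addTopRow q T)
  Rows-addTopRow []         []       []              = []
  Rows-addTopRow (x< ∷ inc) []       []              =
    addRow ([] ∷ []) (◁ʰ-addTopRow {c = []} x< [] []) (Rows-addTopRow inc [] [])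
  Rows-addTopRow (x< ∷ inc) (x≤ ∷ ov) (addRow s h rs) =
    addRow (x≤ ∷ s) (◁ʰ-addTopRow x< h ov) (Rows-addTopRow inc ov rs)

  Rows-transpose : ∀ {Q} → RowStrict Q → Rows (transpose Q)
  Rows-transpose []                 = []
  Rows-transpose (addRow inc dom rs) = Rows-addTopRow inc (Over-transpose dom rs) (Rows-transpose rs)

  Over-large : ∀ {q T} → All (suc i <_) q → Over q T → All (suc i <_) (word T)
  Over-large _        []        = []
  Over-large (p ∷ ps) (x≤ ∷ ov) = ++⁺ (Over-large ps ov) (All.map (<-≤-trans p) x≤)

  -- Each i + 1 of d has an i of c to its left, which matches it; the induction
  -- needs k further closing brackets.
  closing-commutes-row : ∀ {c d} → c ◁ d → AllPairs _≤_ d → All (i ≤_) c →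
                         ∀ k n → cl d (k + suc (cl c n)) ≡ suc (cl d (k + cl c n))
  closing-commutes-row {c} (stop p) _ _ k n rewrite cl-large p (k + suc (cl c n)) | cl-large p (k + cl c n) =
    +-suc k (cl c n)
  closing-commutes-row {y ∷ c} {z ∷ d} (y<z ∷ h) (z≤ ∷ s) (i≤y ∷ i≤c) k n with letter z
  ... | small z<i = contradiction (≤-<-trans i≤y y<z) (<-asym z<i)
  ... | closing   = contradiction (≤-<-trans i≤y y<z) (<-irrefl refl)
  ... | large p   = closing-commutes-row {y ∷ c} {z ∷ d} (stop (p ∷ All.map (<-≤-trans p) z≤)) (z≤ ∷ s) (i≤y ∷ i≤c) k n
  ... | opening with refl ← ≤-antisym i≤y (≤-pred y<z)
    rewrite cl₁-closing (cl c n) | cl₁-opening (cl d (k + suc (suc (cl c n)))) | cl₁-opening (cl d (k + suc (cl c n)))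
          | +-suc k (suc (cl c n))
          | closing-commutes-row h s i≤c (suc k) n
          | closing-commutes-row h s i≤c k n
    = trans (cong (cl d) (sym (+-suc k (cl c n)))) (closing-commutes-row h s i≤c k n)

  -- Moves the corner `x` of a new first column in front of all rows below it. Only `x = i` needs an
  -- argument: then just the row directly below can contain an `i + 1`, and the row `c` already
  -- matches each of these. For `x = i + 1` the rows below contain no brackets.
  letter-commutes : ∀ {x q c T} → Increasing (x ∷ q) → Over q T → All (x ≤_) c → c ◁ʰ T → Rows T →
                    ∀ n → cl (word T) (cl₁ x (cl c n)) ≡ cl₁ x (cl (word T) (cl c n))
  letter-commutes _ [] _ _ _ n = refl
  letter-commutes {x} {c = c} {T = d ∷ T} (x< ∷ q<) ov@(_ ∷ ov′) x≤c [ h ] (addRow s _ _) n with letter x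
  ... | small p rewrite cl₁-small p (cl c n) | cl₁-small p (cl (word (d ∷ T)) (cl c n)) = refl
  ... | large p rewrite cl₁-large p (cl c n) | cl₁-large p (cl (word (d ∷ T)) (cl c n)) = refl
  ... | opening rewrite cl-large (Over-large x< ov) (cl₁ x (cl c n)) | cl-large (Over-large x< ov) (cl c n) = refl
  ... | closing = begin
    cl (word T ++ d) (cl₁ i (cl c n))    ≡⟨ drop-tail _ ⟩
    cl d (cl₁ i (cl c n))                ≡⟨ cong (cl d) (cl₁-closing (cl c n)) ⟩
    cl d (suc (cl c n))                  ≡⟨ closing-commutes-row h s x≤c 0 n ⟩
    suc (cl d (cl c n))                  ≡⟨ cong suc (drop-tail _) ⟨
    suc (cl (word T ++ d) (cl c n))      ≡⟨ cl₁-closing _ ⟨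
    cl₁ i (cl (word T ++ d) (cl c n))    ∎
    where
    open ≡-Reasoning
    tail-large : All (suc i <_) (word T)
    tail-large = Over-large (above (All.head x<) (AllPairs.head q<)) ov′
    drop-tail : ∀ m → cl (word T ++ d) m ≡ cl d m
    drop-tail m = trans (cl-++ (word T) d m) (cl-large tail-large (cl d m))

  -- Moving the corners to the front one after the other turns the reading by rows into the new
  -- column read upwards followed by the word of `T`.
  cl-addTopRow : ∀ {q T} → Increasing q → Over q T → Rows T →
                 ∀ n → cl (word (addTopRow q T)) n ≡ clR q (cl (word T) n)
  cl-addCorner : ∀ {x q c T} → Increasing (x ∷ q) → Over q T → All (x ≤_) c → c ◁ʰ T → Rows T →
                 ∀ n → cl (word (addTopRow q T) ++ x ∷ c) n ≡ clR (x ∷ q) (cl (word T ++ c) n)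
  cl-addTopRow {[]}    _   []        []              n = refl
  cl-addTopRow {_ ∷ _} inc []        []              n = cl-addCorner inc [] [] [] [] n
  cl-addTopRow         inc (x≤ ∷ ov) (addRow _ h rs) n = cl-addCorner inc ov x≤ h rs n
  cl-addCorner {x} {q} {c} {T} inc@(_ ∷ inc′) ov x≤c h rs n = begin
    cl (word (addTopRow q T) ++ x ∷ c) n        ≡⟨ cl-++ (word (addTopRow q T)) (x ∷ c) n ⟩
    cl (word (addTopRow q T)) (cl₁ x (cl c n))  ≡⟨ cl-addTopRow inc′ ov rs _ ⟩
    clR q (cl (word T) (cl₁ x (cl c n)))        ≡⟨ cong (clR q) (letter-commutes inc ov x≤c h rs n) ⟩
    clR q (cl₁ x (cl (word T) (cl c n)))        ≡⟨ cong (λ m → clR q (cl₁ x m)) (cl-++ (word T) c n) ⟨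
    clR q (cl₁ x (cl (word T ++ c) n))          ∎
    where open ≡-Reasoning

  cl-transpose : ∀ {Q} → RowStrict Q → ∀ n → cl (word (transpose Q)) n ≡ clT Q n
  cl-transpose [] n = refl
  cl-transpose (addRow {x} {R} inc dom rs) n =
    trans (cl-addTopRow inc (Over-transpose dom rs) (Rows-transpose rs) n) (cong (clR (x ∷ R)) (cl-transpose rs n))

  cl-reverse : ∀ R n → cl (reverse R) n ≡ clR R n
  cl-reverse []      n = refl
  cl-reverse (x ∷ R) n rewrite unfold-reverse x R = trans (cl-++ (reverse R) _ n) (cl-reverse R (cl₁ x n))

  op-reverse : ∀ R n → op (reverse R) n ≡ opR R n
  op-reverse []      n = refl
  op-reverse (x ∷ R) n rewrite unfold-reverse x R = trans (op-++ (reverse R) _ n) (cong (op₁ x) (op-reverse R n))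

  op-addCorner : ∀ {x q c T} → Increasing (x ∷ q) → Over q T → All (x ≤_) c → c ◁ʰ T → Rows T →
                 ∀ n → op (word (addTopRow q T) ++ x ∷ c) n ≡ op (word T ++ c) (opR (x ∷ q) n)
  op-addCorner {x} {q} {c} {T} inc ov x≤c h rs n = begin
    op (word (addTopRow q T) ++ x ∷ c) n
      ≡⟨ op-cong (word (addTopRow q T) ++ x ∷ c) (reverse (x ∷ q) ++ word T ++ c)
           (λ m → trans (cl-addCorner inc ov x≤c h rs m)
             (sym (trans (cl-++ (reverse (x ∷ q)) (word T ++ c) m) (cl-reverse (x ∷ q) (cl (word T ++ c) m))))) n ⟩
    op (reverse (x ∷ q) ++ word T ++ c) n
      ≡⟨ op-++ (reverse (x ∷ q)) (word T ++ c) n ⟩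
    op (word T ++ c) (op (reverse (x ∷ q)) n)
      ≡⟨ cong (op (word T ++ c)) (op-reverse (x ∷ q) n) ⟩
    op (word T ++ c) (opR (x ∷ q) n) ∎
    where open ≡-Reasoning

  -- Raise on the reading word of T followed by a word with n unmatched i's.
  data RaiseRows : ℕ → ℕ → List (List ℕ) → List (List ℕ) → Set where
    here  : ∀ {j n c D T} → cl D n ≡ 0 → op (word T ++ c) j ≡ 0 → c ◁ʰ T →
            RaiseRows j n ((c ++ suc i ∷ D) ∷ T) ((c ++ i ∷ D) ∷ T)
    there : ∀ {j n c T T′} → RaiseRows j (cl c n) T T′ → RaiseRows j n (c ∷ T) (c ∷ T′)

  -- The bound comes from the raised tableau: its changed row contains `i`, so the entry of `q` in
  -- that row is at most `i`, and `x` is smaller.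
  RaiseRows-bound : ∀ {x q j n T T′} → All (x <_) q → RaiseRows j n T T′ → Over q T′ → x < i
  RaiseRows-bound (x<y ∷ _) (here {c = c} _ _ _) (y≤ ∷ _)  = <-≤-trans x<y (All.head (++⁻ʳ c y≤))
  RaiseRows-bound (_ ∷ x<)  (there r)            (_ ∷ ov) = RaiseRows-bound x< r ov

  -- Entries of `q` above the changed row are less than `i` and thus no brackets; those from that
  -- row downwards are moved to the front by `op-addCorner`.
  RaiseRows-addTopRow : ∀ {q j n T T′} → Increasing q → Over q T → Over q T′ → Rows T →
                        RaiseRows (opR q j) n T T′ → RaiseRows j n (addTopRow q T) (addTopRow q T′)
  RaiseRows-addTopRow {j = j} inc@(x< ∷ _) (x≤ ∷ ov) _ (addRow _ _ rs) (here {c = c} D≡ op≡ h) =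
    here D≡ (trans (op-addCorner inc ov (++⁻ˡ c x≤) h rs j) op≡) (◁ʰ-addTopRow x< h ov)
  RaiseRows-addTopRow {x ∷ q} {j} {n} {c ∷ _} (x< ∷ inc) (_ ∷ ov) (_ ∷ ov′) (addRow _ _ rs) (there r)
    with x<i ← RaiseRows-bound x< r ov′ =
    there (RaiseRows-addTopRow inc ov ov′ rs
      (subst₂ (λ j n → RaiseRows j n _ _) (op₁-small x<i (opR q j)) (sym (cl₁-small x<i (cl c n))) r))

  addTopRow-large : ∀ {H T} → All (suc i <_) H → Over H T → All (suc i <_) (word (addTopRow H T))
  addTopRow-large p ov = Over-large p (Over-addTopRow (Dominates-refl _) ov)

  -- The changed row is cut just before its `i + 1`, so the row below may overhang the remaining
  -- piece; its overhanging entries exceed `i + 1`, as `stop` requires.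
  []-◁ʰ : ∀ {T} → All (suc i <_) (word T) → [] ◁ʰ T
  []-◁ʰ {[]}    _ = []
  []-◁ʰ {_ ∷ T} p = [ stop (++⁻ʳ (word T) p) ]

  RaiseRow⇒RaiseRows : ∀ {R R′ n T} → RaiseRow R R′ → Over R T → cl (word T) n ≡ 0 →
                       RaiseRows 0 n (addTopRow R T) (addTopRow R′ T)
  RaiseRow⇒RaiseRows (here p) [] eq =
    here {c = []} eq (op-large (++⁺ (addTopRow-large p []) []) 0) ([]-◁ʰ (addTopRow-large p []))
  RaiseRow⇒RaiseRows {n = n} (here p) (_∷_ {c = c} {T} _ ov) eq =
    here {c = []} (trans (sym (cl-large (Over-large p ov) (cl c n))) (trans (sym (cl-++ (word T) c n)) eq))
      (op-large (++⁺ (addTopRow-large p ov) []) 0) ([]-◁ʰ (addTopRow-large p ov))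
  RaiseRow⇒RaiseRows {n = n} (there x<i r) [] eq =
    there (RaiseRow⇒RaiseRows r [] (trans (cl₁-small x<i n) eq))
  RaiseRow⇒RaiseRows {n = n} (there x<i r) (_∷_ {c = c} {T} _ ov) eq =
    there (RaiseRow⇒RaiseRows r ov
      (trans (cong (cl (word T)) (cl₁-small x<i (cl c n))) (trans (sym (cl-++ (word T) c n)) eq)))

  RaiseTableau⇒RaiseRows : ∀ {j Q Q′} → RowStrict Q → RowStrict Q′ → RaiseTableau j Q Q′ →
                           RaiseRows j 0 (transpose Q) (transpose Q′)
  RaiseTableau⇒RaiseRows (addRow _ dom rs) _ (here r eq) =
    RaiseRow⇒RaiseRows r (Over-transpose dom rs) (trans (cl-transpose rs 0) eq)
  RaiseTableau⇒RaiseRows (addRow inc dom rs) (addRow _ dom′ rs′) (there r) =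
    RaiseRows-addTopRow inc (Over-transpose dom rs) (Over-transpose dom′ rs′) (Rows-transpose rs)
      (RaiseTableau⇒RaiseRows rs rs′ r)

  RaiseRows-lengths : ∀ {j n T T′} → RaiseRows j n T T′ → map length T ≡ map length T′
  RaiseRows-lengths (here {c = c} {D} _ _ _) = cong (_∷ _) (trans (length-++ c) (sym (length-++ c)))
  RaiseRows-lengths (there r)                = cong (_ ∷_) (RaiseRows-lengths r)

  RaiseRows⇒Raise : ∀ {j n T T′} → RaiseRows j n T T′ → ∀ v → cl v 0 ≡ n → Raise j (word T ++ v) (word T′ ++ v)
  RaiseRows⇒Raise (here {c = c} {D} {T} D≡ op≡ _) v refl =
    subst₂ (Raise _) (reassoc (suc i)) (reassoc i)
      (Raise-++ (word T ++ c) (subst (λ j → Raise j _ _) (sym op≡) (here (trans (cl-++ D v 0) D≡))))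
    where
    reassoc : ∀ x → (word T ++ c) ++ x ∷ D ++ v ≡ (word T ++ c ++ x ∷ D) ++ v
    reassoc x = begin
      (word T ++ c) ++ (x ∷ D) ++ v   ≡⟨ ++-assoc (word T ++ c) (x ∷ D) v ⟨
      ((word T ++ c) ++ x ∷ D) ++ v   ≡⟨ cong (_++ v) (++-assoc (word T) c (x ∷ D)) ⟩
      (word T ++ c ++ x ∷ D) ++ v     ∎
      where open ≡-Reasoning
  RaiseRows⇒Raise (there {c = c} {T} {T′} r) v refl =
    subst₂ (Raise _) (sym (++-assoc (word T) c v)) (sym (++-assoc (word T′) c v))
      (RaiseRows⇒Raise r (c ++ v) (cl-++ c v 0))

  onTransposed-just : ∀ g {Q Q′} → RowStrict Q′ → map length (transpose Q) ≡ map length (transpose Q′) →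
                      g i (word (transpose Q)) ≡ just (word (transpose Q′)) → onTransposed g i Q ≡ just Q′
  onTransposed-just g {Q} {Q′} rs lengths eq
    rewrite readingWord≡word (transpose Q) | eq | withReadingWord-word (transpose Q) (transpose Q′) lengths =
    cong just (transpose-involutive rs)

  raise-transposed : ∀ {Q Q′} → RowStrict Q → RowStrict Q′ → RaiseTableau 0 Q Q′ →
                     eᵗ i Q ≡ just Q′ × fᵗ i Q′ ≡ just Q
  raise-transposed {Q} {Q′} rs rs′ r =
    onTransposed-just e {Q} rs′ lengths (Raise⇒e raise) , onTransposed-just f {Q′} rs (sym lengths) (Raise⇒f raise)
    where
    rows = RaiseTableau⇒RaiseRows rs rs′ r
    lengths = RaiseRows-lengths rows
    raise = subst₂ (Raise 0) (++-identityʳ _) (++-identityʳ _) (RaiseRows⇒Raise rows [] refl)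

  -- Crystal operators on biwords

  zip-tops : ∀ C → zip (tops C) (map proj₂ C) ≡ C
  zip-tops []      = refl
  zip-tops (c ∷ C) = cong (c ∷_) (zip-tops C)

  raiseTop : ∀ {j w} C → Raise j (tops C) w → RaiseTop j C (zip w (map proj₂ C))
  raiseTop (_ ∷ C) (here eq) rewrite zip-tops C = here eq
  raiseTop (_ ∷ C) (there r) = there (raiseTop C r)

  lowerTop : ∀ {j w} C → Raise j w (tops C) → RaiseTop j (zip w (map proj₂ C)) C
  lowerTop (_ ∷ C) (here eq) rewrite zip-tops C = here eq
  lowerTop (_ ∷ C) (there r) = there (lowerTop C r)

  onTopRow-just : ∀ g C {V} → onTopRow g i C ≡ just V →
                  ∃[ w ] g i (tops C) ≡ just w × V ≡ zip w (map proj₂ C)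
  onTopRow-just g C eq with g i (tops C)
  onTopRow-just g C refl | just w = w , refl , refl

  ẽ⇒RaiseTop : ∀ {C V} → ẽ i C ≡ just V → RaiseTop 0 C V
  ẽ⇒RaiseTop {C} eq with w , eq′ , refl ← onTopRow-just e C eq = raiseTop C (e⇒Raise (tops C) eq′)

  f̃⇒RaiseTop : ∀ {C V} → f̃ i C ≡ just V → RaiseTop 0 V C
  f̃⇒RaiseTop {C} eq with w , eq′ , refl ← onTopRow-just f C eq = lowerTop C (f⇒Raise (tops C) eq′)

  RaiseTop-All : ∀ {P : ℕ × ℕ → Set} {j C C′} → (∀ {b} → P (suc i , b) → P (i , b)) →
                 RaiseTop j C C′ → All P C → All P C′
  RaiseTop-All h (here _)  (p ∷ ps) = h p ∷ ps
  RaiseTop-All h (there r) (p ∷ ps) = p ∷ RaiseTop-All h r ps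

  ≻-closing : ∀ {c b} → c ≻ (suc i , b) → c ≻ (i , b)
  ≻-closing (inj₁ p)          = inj₁ p
  ≻-closing (inj₂ (refl , p)) = inj₂ (refl , <-trans (n<1+n i) p)

  -- An i right behind the raised i + 1 would have matched it.
  RaiseTop-sorted : ∀ {j C C′} → RaiseTop j C C′ → AllPairs _≻_ C → AllPairs _≻_ C′
  RaiseTop-sorted (there r) (c≻ ∷ s) = RaiseTop-All ≻-closing r c≻ ∷ RaiseTop-sorted r s
  RaiseTop-sorted (here {D = []} _) _ = [] ∷ []
  RaiseTop-sorted (here {b} {c ∷ D} eq) ((c₁≻c ∷ _) ∷ s) =
    (≻c c₁≻c ∷ All.map (≻-trans (≻c c₁≻c)) (AllPairs.head s)) ∷ s
    where
    ≻c : (suc i , b) ≻ c → (i , b) ≻ c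
    ≻c (inj₁ p) = inj₁ p
    ≻c (inj₂ (refl , t≤i)) with m≤n⇒m<n∨m≡n (≤-pred t≤i)
    ...   | inj₁ t<i = inj₂ (refl , t<i)
    ...   | inj₂ refl with () ← trans (sym (cl₁-closing _)) eq

  -- An `i + 1` directly in front of the changed letter and with the same bottom entry would be an
  -- opening left over, which `RaiseTop` forbids.
  RaiseTop-sorted⁻ : ∀ {j C C′} → RaiseTop j C C′ → AllPairs _≻_ C′ → AllPairs _≻_ C
  RaiseTop-sorted⁻ (here _) (c≻ ∷ s) = All.map (≻-trans (inj₂ (refl , n<1+n i))) c≻ ∷ s
  RaiseTop-sorted⁻ {j} (there {t = t} {b} r) (c≻ ∷ s) = prepend r refl c≻ (RaiseTop-sorted⁻ r s)
    where
    prepend : ∀ {k C C′} → RaiseTop k C C′ → op₁ t j ≡ k → All ((t , b) ≻_) C′ → AllPairs _≻_ C →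
              AllPairs _≻_ ((t , b) ∷ C)
    prepend (there _) _ (c≻ ∷ _) s = (c≻ ∷ All.map (≻-trans c≻) (AllPairs.head s)) ∷ s
    prepend (here {b′} _) eq (c≻ ∷ _) s = (≻c′ c≻ ∷ All.map (≻-trans (≻c′ c≻)) (AllPairs.head s)) ∷ s
      where
      ≻c′ : (t , b) ≻ (i , b′) → (t , b) ≻ (suc i , b′)
      ≻c′ (inj₁ p) = inj₁ p
      ≻c′ (inj₂ (refl , i<t)) with m≤n⇒m<n∨m≡n i<t
      ...   | inj₁ p = inj₂ (refl , p)
      ...   | inj₂ refl with () ← trans (sym (op₁-opening j)) eq

  raise-rsk : ∀ {W W′ C C′} → AllPairs _≺_ W → AllPairs _≺_ W′ → C ↭ W → C′ ↭ W′ →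
              AllPairs _≻_ C → AllPairs _≻_ C′ → RaiseTop 0 C C′ →
              ins W ≡ ins W′ × eᵗ i (rec W) ≡ just (rec W′) × fᵗ i (rec W′) ≡ just (rec W)
  raise-rsk sW sW′ C↭W C′↭W′ sC sC′ r
    with d ← rsk-dual sW sC C↭W | d′ ← rsk-dual sW′ sC′ C′↭W′
    with Q′ , d″ , rQ ← raiseDual r d
    with P≡ , refl ← Dual-unique d″ d′
    = P≡ , raise-transposed (Dual-RowStrict d) (Dual-RowStrict d′) rQ

  -- Stated for any Burge arrangement `W′` of the columns of `V`, to cover both the Burge word of a
  -- filling and `toBurge V`. That the columns of `W′` are distinct follows from the strict order of
  -- `V`.
  ẽ-rsk : ∀ {W W′ V} → BurgeSorted W → Unique W → BurgeSorted W′ → V ↭ W′ → ẽ i (toCrystal W) ≡ just V →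
          ins W ≡ ins W′ × eᵗ i (rec W) ≡ just (rec W′)
  ẽ-rsk {W} sW uW sW′ V↭W′ eq
    with r ← ẽ⇒RaiseTop eq | sC ← crystal-strict uW
    with sV ← RaiseTop-sorted r sC
    with P≡ , e≡ , _ ← raise-rsk (burge-strict sW uW) (burge-strict sW′ (Unique-↭ V↭W′ (≻⇒Unique sV)))
                         (Sort.sort-↭ crystalOrder W) V↭W′ sC sV r
    = P≡ , e≡

  -- Lowering is raising read backwards: here `V` is the word that is raised to the crystal word of
  -- `W`.
  f̃-rsk : ∀ {W W′ V} → BurgeSorted W → Unique W → BurgeSorted W′ → V ↭ W′ → f̃ i (toCrystal W) ≡ just V →
          ins W ≡ ins W′ × fᵗ i (rec W) ≡ just (rec W′)
  f̃-rsk {W} sW uW sW′ V↭W′ eq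
    with r ← f̃⇒RaiseTop eq | sC ← crystal-strict uW
    with sV ← RaiseTop-sorted⁻ r sC
    with P≡ , _ , f≡ ← raise-rsk (burge-strict sW′ (Unique-↭ V↭W′ (≻⇒Unique sV))) (burge-strict sW uW)
                         V↭W′ (Sort.sort-↭ crystalOrder W) sV sC r
    = sym P≡ , f≡

-- Burge words of fillings

toBurge-sorted : ∀ V → BurgeSorted (toBurge V)
toBurge-sorted = Sort.sort-↗ burgeOrder

boxes-unique : ∀ S → Unique (boxes S)
boxes-unique S = Unique.filter⁺ (box? S)
  (Unique.cartesianProduct⁺ (Unique.upTo⁺ (suc (length (parts (outer S))))) (Unique.upTo⁺ (suc (row (outer S) 1))))

boxes-Box : ∀ S → All (λ (i , j) → Box S i j) (boxes S)
boxes-Box S = All.all-filter (box? S)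
  (cartesianProduct (upTo (suc (length (parts (outer S))))) (upTo (suc (row (outer S) 1))))

-- An entry can recur only in another column of the shape, where the bottom letter differs.
COF⇒Unique : ∀ {S F} → COF S F → Unique (burgeWord S F)
COF⇒Unique {S} {F} cof = Unique-↭ (↭-sym (Sort.sort-↭ burgeOrder _))
  (AllPairs.map⁺ (distinct (boxes-Box S) (boxes-unique S)))
  where
  entry : ℕ × ℕ → ℕ × ℕ
  entry (i , j) = F i j , j
  entry-≢ : ∀ {x y} → Box S (proj₁ x) (proj₂ x) → Box S (proj₁ y) (proj₂ y) → x ≢ y → entry x ≢ entry y
  entry-≢ {i , j} {i′ , j′} bx by x≢y eq with refl ← cong proj₂ eq =
    COF.distinct cof bx by (λ { refl → x≢y refl }) (cong proj₁ eq)
  distinct : ∀ {xs} → All (λ (i , j) → Box S i j) xs → Unique xs → AllPairs (λ x y → entry x ≢ entry y) xs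
  distinct []         []       = []
  distinct (bx ∷ bxs) (u ∷ us) = All.zipWith (λ (by , x≢y) → entry-≢ bx by x≢y) (bxs , u) ∷ distinct bxs us

theorem41 : ((S : SkewShape) (F : Filling) → COF S F → (i : ℕ) → 1 ≤ i →
    (∀ F′ → IsẼ S i F F′ → insF S F ≡ insF S F′ × eᵗ i (recF S F) ≡ just (recF S F′))
    × (∀ F′ → IsF̃ S i F F′ → insF S F ≡ insF S F′ × fᵗ i (recF S F) ≡ just (recF S F′)))
    × ((W : Biword) → IsBurge W → (i : ℕ) → 1 ≤ i →
    (∀ V → ẽ i (toCrystal W) ≡ just V →
    ins W ≡ ins (toBurge V) × eᵗ i (rec W) ≡ just (rec (toBurge V)))
    × (∀ V → f̃ i (toCrystal W) ≡ just V →
    ins W ≡ ins (toBurge V) × fᵗ i (rec W) ≡ just (rec (toBurge V))))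
theorem41 =
  (λ S F cof i _ →
      (λ F′ (_ , eq) → Crystal.ẽ-rsk i (toBurge-sorted _) (COF⇒Unique cof) (toBurge-sorted _)
                         (Sort.sort-↭ crystalOrder _) eq)
    , (λ F′ (_ , eq) → Crystal.f̃-rsk i (toBurge-sorted _) (COF⇒Unique cof) (toBurge-sorted _)
                         (Sort.sort-↭ crystalOrder _) eq)) ,
  (λ W burge i _ →
      (λ V eq → Crystal.ẽ-rsk i (IsBurge.sorted burge) (IsBurge.distinct burge) (toBurge-sorted V)
                  (↭-sym (Sort.sort-↭ burgeOrder V)) eq)
    , (λ V eq → Crystal.f̃-rsk i (IsBurge.sorted burge) (IsBurge.distinct burge) (toBurge-sorted V)
                  (↭-sym (Sort.sort-↭ burgeOrder V)) eq))
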